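{- Let $n\geq 4$ and $2\leq i<n$ be integers, and let $a,b$ be rational numbers with $b\neq 0$. Then the system of Diophantine equations \[ \sigma_{i}(x_{1},\ldots,x_{n})=a,\qquad \sigma_{n}(x_{1},\ldots,x_{n})=b \] has infinitely many rational parametric solutions depending on $n-3$ free parameters; that is, there are infinitely many distinct $n$-tuples $(x_1,\ldots,x_n)$ of rational functions in $n-3$ independent indeterminates over $\mathbb{Q}$ which satisfy the system identically.
   Context: For $1\leq i\leq n$, $\sigma_{i}(x_{1},\ldots,x_{n})=\sum_{1\leq k_{1}<k_{2}<\cdots<k_{i}\leq n}x_{k_{1}}\cdots x_{k_{i}}$ denotes the $i$-th elementary symmetric polynomial; $\sigma_n$ is the product of the variables. -}

module Defs where

open import Data.Nat using (ℕ; zero; suc)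
open import Data.Fin using (Fin)
import Data.Fin as Fin
open import Data.Rational using (ℚ; 0ℚ; 1ℚ; _+_; _*_; -_)
open import Data.Product using (Σ; ∃; _×_)
open import Relation.Binary.PropositionalEquality using (_≡_; _≢_)
open import Relation.Nullary using (¬_)

σ : (i : ℕ) {n : ℕ} → (Fin n → ℚ) → ℚ
σ zero    {_}     x = 1ℚ
σ (suc i) {zero}  x = 0ℚ
σ (suc i) {suc n} x = x Fin.zero * σ i (λ k → x (Fin.suc k))
                      + σ (suc i) (λ k → x (Fin.suc k))

data Poly (m : ℕ) : Set where
  con : ℚ → Poly m
  var : Fin m → Poly m
  _⊕_ : Poly m → Poly m → Poly m
  _⊗_ : Poly m → Poly m → Poly m
  ⊖_  : Poly m → Poly m

eval : {m : ℕ} → Poly m → (Fin m → ℚ) → ℚ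
eval (con c) t = c
eval (var j) t = t j
eval (p ⊕ q) t = eval p t + eval q t
eval (p ⊗ q) t = eval p t * eval q t
eval (⊖ p)   t = - eval p t

-- Since ℚ is infinite, a polynomial is the zero polynomial iff it vanishes
-- at every point of ℚ^m; so "nonzero polynomial" = "nonzero at some point".
NonZeroPoly : {m : ℕ} → Poly m → Set
NonZeroPoly {m} p = ∃ λ (t : Fin m → ℚ) → eval p t ≢ 0ℚ

record RatFun (m : ℕ) : Set where
  constructor _∕_⟨_⟩
  field
    num    : Poly m
    den    : Poly m
    den≢0  : NonZeroPoly den
open RatFun public

_≈ᴿ_ : {m : ℕ} → RatFun m → RatFun m → Set
f ≈ᴿ g = ∀ t → eval (num f) t * eval (den g) t ≡ eval (num g) t * eval (den f) t

Tuple : ℕ → ℕ → Set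
Tuple n m = Fin n → RatFun m

Defined : {n m : ℕ} → Tuple n m → (Fin m → ℚ) → Set
Defined {n} x t = (k : Fin n) → eval (den (x k)) t ≢ 0ℚ

value : {n m : ℕ} (x : Tuple n m) (t : Fin m → ℚ) → Defined x t → Fin n → ℚ
value x t d k = eval (num (x k)) t Data.Rational.÷ eval (den (x k)) t
  where open import Data.Rational using (_÷_)
        instance
          nz : Data.Rational.NonZero (eval (den (x k)) t)
          nz = Data.Rational.≢-nonZero (d k)

-- x satisfies σ_i(x) = a, σ_n(x) = b identically in ℚ(t).  Since ℚ^m is
-- infinite, a rational-function identity holds iff it holds at every point
-- of the (Zariski-dense) domain of definition.
SolvesSystem : {n m : ℕ} (i : ℕ) (a b : ℚ) → Tuple n m → Set
SolvesSystem {n} i a b x =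
  ∀ t (d : Defined x t) → (σ i (value x t d) ≡ a) × (σ n (value x t d) ≡ b)

_≈ᵀ_ : {n m : ℕ} → Tuple n m → Tuple n m → Set
x ≈ᵀ y = ∀ k → x k ≈ᴿ y k

AlgIndep : {m : ℕ} → (Fin m → RatFun m) → Set
AlgIndep {m} f = (P : Poly m) → NonZeroPoly P →
  ∃ λ t → Σ (Defined f t) λ d → eval P (value f t d) ≢ 0ℚ

-- The tuple genuinely depends on m independent parameters: some m of its
-- coordinates (at distinct positions) are algebraically independent over ℚ
-- (i.e. ℚ(x₁,…,x_n) has transcendence degree m).
DependsOnAll : {n m : ℕ} → Tuple n m → Set
DependsOnAll {n} {m} x =
  ∃ λ (c : Fin m → Fin n) → (∀ j j' → c j ≡ c j' → j ≡ j') × AlgIndep (λ j → x (c j))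

{-# OPTIONS --safe #-}

-- For 2 ≤ i ≤ n − 2, let x₄, …, x_n be free.  In the remaining three unknowns the
-- system reads α xyz + β (xy + xz + yz) + γ (x + y + z) + δ = a, xyz = b / U, where α, β, γ, δ and U
-- are elementary symmetric polynomials of x₄, …, x_n.  This is a plane cubic with rational points at
-- infinity, and the tangent at one of them meets it in a finite point, rational over ℚ(x₄, …, x_n).
--
-- For i = n − 1 pass to reciprocals: the system becomes "prescribed sum p and product q".  With all
-- but four unknowns free, fix the product v of two of the four and q / v of the other two; a tangent
-- to the resulting cubic gives a solution with parameter v, as long as p is not zero.
-- The one exception, n = 4 and a = 0, is Euler's parametric solution of xyz(x + y + z) = A.
--
-- In each case some coordinate is unbounded as the first parameter varies, while the others used are
-- parameters themselves.  A nonzero univariate polynomial does not vanish far from the origin, so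
-- these coordinates are algebraically independent; and translating the first parameter by suitable
-- constants produces infinitely many distinct tuples.
module Submission where

open import Defs
open Defs using () renaming (_⊕_ to infixl 6 _⊞_; _⊗_ to infixl 7 _⊠_)
open import Data.Nat using (ℕ; zero; suc; z≤n; s≤s; _≤_; _<_; _∸_)
import Data.Nat as ℕ
import Data.Nat.Properties as ℕ
import Data.Integer as ℤ
open import Data.Fin as Fin using (Fin)
open import Data.List using (List; []; _∷_; map)
open import Data.Rational using (ℚ; 0ℚ; 1ℚ; _+_; _*_; -_; _-_; _÷_; 1/_; ∣_∣; _⊔_; positive; nonNegative; ≢-nonZero)
import Data.Rational as ℚ
open import Data.Rational.Properties
open import Data.Rational.Solver using (module +-*-Solver)
open import Data.Product using (Σ; ∃; _×_; _,_; proj₁; proj₂)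
open import Data.Sum using (_⊎_; inj₁; inj₂)
open import Data.Empty using (⊥-elim)
open import Function using (_∘_)
open import Relation.Binary.Definitions using (tri<; tri≈; tri>)
open import Relation.Binary.PropositionalEquality
open import Relation.Nullary using (¬_; yes; no)

open +-*-Solver using (solve; _:=_; _:+_; _:*_; :-_; _:-_) renaming (con to κ)

-- Cancellation and order in ℚ

*-cancelʳ-≡ : ∀ {p q} r → r ≢ 0ℚ → p * r ≡ q * r → p ≡ q
*-cancelʳ-≡ {p} {q} r r≢0 e = begin
  p                ≡⟨ *-identityʳ p ⟨
  p * 1ℚ           ≡⟨ cong (p *_) (*-inverseʳ r) ⟨
  p * (r * 1/ r)   ≡⟨ *-assoc p r _ ⟨
  p * r * 1/ r     ≡⟨ cong (_* 1/ r) e ⟩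
  q * r * 1/ r     ≡⟨ *-assoc q r _ ⟩
  q * (r * 1/ r)   ≡⟨ cong (q *_) (*-inverseʳ r) ⟩
  q * 1ℚ           ≡⟨ *-identityʳ q ⟩
  q                ∎
  where
  open ≡-Reasoning
  instance _ = ≢-nonZero r≢0

*-≢0 : ∀ {p q} → p ≢ 0ℚ → q ≢ 0ℚ → p * q ≢ 0ℚ
*-≢0 {p} {q} p≢0 q≢0 e = p≢0 (*-cancelʳ-≡ q q≢0 (trans e (sym (*-zeroˡ q))))

≢0-factorˡ : ∀ p {q} → p * q ≢ 0ℚ → p ≢ 0ℚ
≢0-factorˡ p {q} pq≢0 p≡0 = pq≢0 (trans (cong (_* q) p≡0) (*-zeroˡ q))

≢0-factorʳ : ∀ p {q} → p * q ≢ 0ℚ → q ≢ 0ℚ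
≢0-factorʳ p pq≢0 q≡0 = pq≢0 (trans (cong (p *_) q≡0) (*-zeroʳ p))

÷-* : ∀ p q (q≢0 : q ≢ 0ℚ) → (p ÷ q) {{≢-nonZero q≢0}} * q ≡ p
÷-* p q q≢0 = trans (*-assoc p _ q)
  (trans (cong (p *_) (*-inverseˡ q {{≢-nonZero q≢0}})) (*-identityʳ p))

0<∣p∣ : ∀ {p} → p ≢ 0ℚ → 0ℚ ℚ.< ∣ p ∣
0<∣p∣ {p} p≢0 = ≰⇒> λ ∣p∣≤0 → p≢0 (∣p∣≡0⇒p≡0 p (≤-antisym ∣p∣≤0 (0≤∣p∣ p)))

≢0-∣∣ : ∀ {p ε} → 0ℚ ℚ.< ε → ε ℚ.≤ ∣ p ∣ → p ≢ 0ℚ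
≢0-∣∣ ε>0 ε≤∣p∣ refl = <-irrefl refl (<-≤-trans ε>0 ε≤∣p∣)

p≤∣p∣ : ∀ p → p ℚ.≤ ∣ p ∣
p≤∣p∣ p with ≤-total 0ℚ p
... | inj₁ 0≤p = ≤-reflexive (sym (0≤p⇒∣p∣≡p 0≤p))
... | inj₂ p≤0 = ≤-trans p≤0 (0≤∣p∣ p)

*-mono-≤ : ∀ {p q r s} → 0ℚ ℚ.≤ p → 0ℚ ℚ.≤ r → p ℚ.≤ q → r ℚ.≤ s → p * r ℚ.≤ q * s
*-mono-≤ {p} {q} {r} {s} 0≤p 0≤r p≤q r≤s = ≤-trans
  (*-monoʳ-≤-nonNeg r {{nonNegative 0≤r}} p≤q)
  (*-monoˡ-≤-nonNeg q {{nonNegative (≤-trans 0≤p p≤q)}} r≤s)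

0≤* : ∀ {p q} → 0ℚ ℚ.≤ p → 0ℚ ℚ.≤ q → 0ℚ ℚ.≤ p * q
0≤* {p} {q} 0≤p 0≤q = subst (ℚ._≤ p * q) (*-zeroˡ q) (*-monoʳ-≤-nonNeg q {{nonNegative 0≤q}} 0≤p)

0≤+ : ∀ {p q} → 0ℚ ℚ.≤ p → 0ℚ ℚ.≤ q → 0ℚ ℚ.≤ p + q
0≤+ = +-mono-≤

p≤p+q : ∀ {p q} → 0ℚ ℚ.≤ q → p ℚ.≤ p + q
p≤p+q {p} {q} 0≤q = subst (ℚ._≤ p + q) (+-identityʳ p) (+-monoʳ-≤ p 0≤q)

+-cancelʳ-≤ : ∀ r {p q} → p + r ℚ.≤ q + r → p ℚ.≤ q
+-cancelʳ-≤ r {p} {q} h = subst₂ ℚ._≤_ (e p) (e q) (+-monoˡ-≤ (- r) h)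
  where
  e : ∀ p → p + r - r ≡ p
  e p = solve 2 (λ p r → p :+ r :- r := p) refl p r

-- Univariate polynomials as coefficient lists, constant term first

_at_ : List ℚ → ℚ → ℚ
[]      at x = 0ℚ
(c ∷ f) at x = c + x * (f at x)

_+ᴸ_ : List ℚ → List ℚ → List ℚ
[]      +ᴸ g       = g
(c ∷ f) +ᴸ []      = c ∷ f
(c ∷ f) +ᴸ (d ∷ g) = (c + d) ∷ (f +ᴸ g)

_·ᴸ_ : ℚ → List ℚ → List ℚ
c ·ᴸ f = map (c *_) f

_*ᴸ_ : List ℚ → List ℚ → List ℚ
[]      *ᴸ g = []
(c ∷ f) *ᴸ g = (c ·ᴸ g) +ᴸ (0ℚ ∷ (f *ᴸ g))

+ᴸ-at : ∀ f g x → (f +ᴸ g) at x ≡ f at x + g at x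
+ᴸ-at []      g       x = sym (+-identityˡ _)
+ᴸ-at (c ∷ f) []      x = sym (+-identityʳ _)
+ᴸ-at (c ∷ f) (d ∷ g) x = trans (cong (λ h → c + d + x * h) (+ᴸ-at f g x))
  (solve 5 (λ c d x y z → c :+ d :+ x :* (y :+ z) := c :+ x :* y :+ (d :+ x :* z)) refl
    c d x (f at x) (g at x))

·ᴸ-at : ∀ c f x → (c ·ᴸ f) at x ≡ c * (f at x)
·ᴸ-at c []      x = sym (*-zeroʳ c)
·ᴸ-at c (d ∷ f) x = trans (cong (λ h → c * d + x * h) (·ᴸ-at c f x))
  (solve 4 (λ c d x y → c :* d :+ x :* (c :* y) := c :* (d :+ x :* y)) refl c d x (f at x))

*ᴸ-at : ∀ f g x → (f *ᴸ g) at x ≡ f at x * g at x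
*ᴸ-at []      g x = sym (*-zeroˡ (g at x))
*ᴸ-at (c ∷ f) g x = trans (+ᴸ-at (c ·ᴸ g) _ x)
  (trans (cong₂ (λ h k → h + (0ℚ + x * k)) (·ᴸ-at c g x) (*ᴸ-at f g x))
  (solve 4 (λ c x y z → c :* z :+ (κ 0ℚ :+ x :* (y :* z)) := (c :+ x :* y) :* z) refl
    c x (f at x) (g at x)))

-- Substituting a univariate polynomial for each variable restricts `p` to a curve, so that
-- nonvanishing far from the origin becomes a question in one variable.
restrict : ∀ {m} → Poly m → (Fin m → List ℚ) → List ℚ
restrict (con c) ℓ = c ∷ []
restrict (var j) ℓ = ℓ j
restrict (p ⊕ q) ℓ = restrict p ℓ +ᴸ restrict q ℓ
restrict (p ⊗ q) ℓ = restrict p ℓ *ᴸ restrict q ℓ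
restrict (⊖ p)   ℓ = (- 1ℚ) ·ᴸ restrict p ℓ

restrict-at : ∀ {m} (p : Poly m) ℓ x → restrict p ℓ at x ≡ eval p (λ j → ℓ j at x)
restrict-at (con c) ℓ x = trans (cong (c +_) (*-zeroʳ x)) (+-identityʳ c)
restrict-at (var j) ℓ x = refl
restrict-at (p ⊕ q) ℓ x = trans (+ᴸ-at (restrict p ℓ) _ x)
  (cong₂ _+_ (restrict-at p ℓ x) (restrict-at q ℓ x))
restrict-at (p ⊗ q) ℓ x = trans (*ᴸ-at (restrict p ℓ) _ x)
  (cong₂ _*_ (restrict-at p ℓ x) (restrict-at q ℓ x))
restrict-at (⊖ p)   ℓ x = trans (·ᴸ-at (- 1ℚ) (restrict p ℓ) x)
  (trans (cong (- 1ℚ *_) (restrict-at p ℓ x))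
         (solve 1 (λ y → κ (- 1ℚ) :* y := :- y) refl (eval p (λ j → ℓ j at x))))

eval-cong : ∀ {m} (p : Poly m) {s t} → (∀ j → s j ≡ t j) → eval p s ≡ eval p t
eval-cong (con c) e = refl
eval-cong (var j) e = e j
eval-cong (p ⊕ q) e = cong₂ _+_ (eval-cong p e) (eval-cong q e)
eval-cong (p ⊗ q) e = cong₂ _*_ (eval-cong p e) (eval-cong q e)
eval-cong (⊖ p)   e = cong -_ (eval-cong p e)

-- Growth at infinity

Eventually : (ℚ → Set) → Set
Eventually P = ∃ λ K → ∀ x → K ℚ.≤ ∣ x ∣ → P x

Coercive : (ℚ → ℚ) → Set
Coercive f = ∀ M → Eventually λ x → M ℚ.≤ ∣ f x ∣

BoundedAway : (ℚ → ℚ) → Set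
BoundedAway f = ∃ λ ε → 0ℚ ℚ.< ε × Eventually λ x → ε ℚ.≤ ∣ f x ∣

both : ∀ {P Q} → Eventually P → Eventually Q → Eventually λ x → P x × Q x
both (K , p) (L , q) = K ⊔ L , λ x h →
  p x (≤-trans (p≤p⊔q K L) h) , q x (≤-trans (p≤q⊔p K L) h)

∣∣-Horner : ∀ c x y → ∣ x ∣ * ∣ y ∣ ℚ.≤ ∣ c + x * y ∣ + ∣ c ∣
∣∣-Horner c x y = begin
  ∣ x ∣ * ∣ y ∣                ≡⟨ ∣p*q∣≡∣p∣*∣q∣ x y ⟨
  ∣ x * y ∣                    ≡⟨ cong ∣_∣ (solve 2 (λ c z → z := c :+ z :- c) refl c (x * y)) ⟩
  ∣ c + x * y - c ∣            ≤⟨ ∣p-q∣≤∣p∣+∣q∣ (c + x * y) c ⟩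
  ∣ c + x * y ∣ + ∣ c ∣        ∎
  where open ≤-Reasoning

-- Since |c + x y| ≥ |x| |y| - |c|, a tail with |y| ≥ ε forces at least linear growth; the threshold
-- `L` solves L ε = M + |c|.
Horner-coercive : ∀ c f → BoundedAway (f at_) → Coercive ((c ∷ f) at_)
Horner-coercive c f (ε , ε>0 , K , away) M = K ⊔ L , λ x h →
  +-cancelʳ-≤ (∣ c ∣) (begin
    M + ∣ c ∣                      ≡⟨ ÷-* (M + ∣ c ∣) ε ε≢0 ⟨
    L * ε                          ≤⟨ *-monoʳ-≤-nonNeg ε {{nonNegative (<⇒≤ ε>0)}} (≤-trans (p≤q⊔p K L) h) ⟩
    ∣ x ∣ * ε                      ≤⟨ *-monoˡ-≤-nonNeg (∣ x ∣) {{∣-∣-nonNeg x}} (away x (≤-trans (p≤p⊔q K L) h)) ⟩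
    ∣ x ∣ * ∣ f at x ∣             ≤⟨ ∣∣-Horner c x (f at x) ⟩
    ∣ c + x * (f at x) ∣ + ∣ c ∣   ∎)
  where
  open ≤-Reasoning
  ε≢0 : ε ≢ 0ℚ
  ε≢0 = <⇒≢ ε>0 ∘ sym
  L = ((M + ∣ c ∣) ÷ ε) {{≢-nonZero ε≢0}}

-- This takes the place of counting roots. Going up the Horner form, a tail that is bounded away
-- from zero makes the whole coercive, and a vanishing tail leaves only the constant c.
zero-or-boundedAway : ∀ f → (∀ x → f at x ≡ 0ℚ) ⊎ BoundedAway (f at_)
zero-or-boundedAway [] = inj₁ λ _ → refl
zero-or-boundedAway (c ∷ f) with zero-or-boundedAway f
... | inj₂ away = inj₂ (1ℚ , positive⁻¹ 1ℚ , Horner-coercive c f away 1ℚ)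
... | inj₁ f≡0 with c ≟ 0ℚ
...   | yes refl = inj₁ λ x → trans (cong (λ y → 0ℚ + x * y) (f≡0 x))
                    (solve 1 (λ x → κ 0ℚ :+ x :* κ 0ℚ := κ 0ℚ) refl x)
...   | no  c≢0  = inj₂ (∣ c ∣ , 0<∣p∣ c≢0 , 0ℚ , λ x _ → ≤-reflexive (cong ∣_∣ (sym
                    (trans (cong (λ y → c + x * y) (f≡0 x))
                    (solve 2 (λ c x → c :+ x :* κ 0ℚ := c) refl c x)))))

boundedAway : ∀ f {x} → f at x ≢ 0ℚ → BoundedAway (f at_)
boundedAway f fx≢0 with zero-or-boundedAway f
... | inj₁ f≡0  = ⊥-elim (fx≢0 (f≡0 _))
... | inj₂ away = away

eventually-≢0 : ∀ f {x} → f at x ≢ 0ℚ → Eventually λ y → f at y ≢ 0ℚ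
eventually-≢0 f fx≢0 with boundedAway f fx≢0
... | ε , ε>0 , K , away = K , λ y h → ≢0-∣∣ ε>0 (away y h)

coercive : ∀ c f {x} → f at x ≢ 0ℚ → Coercive ((c ∷ f) at_)
coercive c f fx≢0 = Horner-coercive c f (boundedAway f fx≢0)

-- The quotient |f| / (|g| + 1) tends to infinity. The summand 1 leaves room to absorb constant
-- terms even where g is small.
Dominates : List ℚ → List ℚ → Set
Dominates f g = ∀ M → 0ℚ ℚ.≤ M → Eventually λ x → M * (∣ g at x ∣ + 1ℚ) ℚ.≤ ∣ f at x ∣

Dominates-const : ∀ {f} d → Coercive (f at_) → Dominates f (d ∷ [])
Dominates-const {f} d coe M _ with coe (M * (∣ d ∣ + 1ℚ))
... | K , large = K , λ x h → subst (λ y → M * (∣ y ∣ + 1ℚ) ℚ.≤ ∣ f at x ∣)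
  (solve 2 (λ d x → d := d :+ x :* κ 0ℚ) refl d x) (large x h)

-- Both polynomials are multiplied by x up to the constants c and d. Dominating the tails with the
-- larger factor M + N, where N = |c| + M |d|, absorbs these constants as soon as |x| ≥ 1.
Dominates-∷ : ∀ c d {f g} → Dominates f g → Dominates (c ∷ f) (d ∷ g)
Dominates-∷ c d {f} {g} dom M 0≤M with dom (M + (∣ c ∣ + M * ∣ d ∣))
  (0≤+ 0≤M (0≤+ (0≤∣p∣ c) (0≤* 0≤M (0≤∣p∣ d))))
... | K , large = K ⊔ 1ℚ , λ x h → let y = f at x; z = g at x; N = ∣ c ∣ + M * ∣ d ∣ in
  +-cancelʳ-≤ (∣ c ∣) (begin
    M * (∣ d + x * z ∣ + 1ℚ) + ∣ c ∣
      ≤⟨ +-monoˡ-≤ (∣ c ∣) (*-monoˡ-≤-nonNeg M {{nonNegative 0≤M}} (+-monoˡ-≤ 1ℚ (∣p+q∣≤∣p∣+∣q∣ d (x * z)))) ⟩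
    M * (∣ d ∣ + ∣ x * z ∣ + 1ℚ) + ∣ c ∣
      ≡⟨ cong (λ w → M * (∣ d ∣ + w + 1ℚ) + ∣ c ∣) (∣p*q∣≡∣p∣*∣q∣ x z) ⟩
    M * (∣ d ∣ + ∣ x ∣ * ∣ z ∣ + 1ℚ) + ∣ c ∣
      ≡⟨ solve 5 (λ M c d x z → M :* (d :+ x :* z :+ κ 1ℚ) :+ c
                    := x :* (M :* z) :+ κ 1ℚ :* (M :+ (c :+ M :* d))) refl
           M (∣ c ∣) (∣ d ∣) (∣ x ∣) (∣ z ∣) ⟩
    ∣ x ∣ * (M * ∣ z ∣) + 1ℚ * (M + N)
      ≤⟨ +-mono-≤
           (*-monoˡ-≤-nonNeg (∣ x ∣) {{∣-∣-nonNeg x}}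
             (*-monoʳ-≤-nonNeg (∣ z ∣) {{∣-∣-nonNeg z}} (p≤p+q {M} 0≤N)))
           (*-monoʳ-≤-nonNeg (M + N) {{nonNegative (0≤+ 0≤M 0≤N)}} (≤-trans (p≤q⊔p K 1ℚ) h)) ⟩
    ∣ x ∣ * ((M + N) * ∣ z ∣) + ∣ x ∣ * (M + N)
      ≡⟨ solve 3 (λ x z N → x :* (N :* z) :+ x :* N := x :* (N :* (z :+ κ 1ℚ))) refl (∣ x ∣) (∣ z ∣) (M + N) ⟩
    ∣ x ∣ * ((M + N) * (∣ z ∣ + 1ℚ))
      ≤⟨ *-monoˡ-≤-nonNeg (∣ x ∣) {{∣-∣-nonNeg x}} (large x (≤-trans (p≤p⊔q K 1ℚ) h)) ⟩
    ∣ x ∣ * ∣ y ∣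
      ≤⟨ ∣∣-Horner c x y ⟩
    ∣ c + x * y ∣ + ∣ c ∣ ∎)
  where
  open ≤-Reasoning
  0≤N = 0≤+ (0≤∣p∣ c) (0≤* 0≤M (0≤∣p∣ d))

-- Nonzero polynomials

-- Join the two witnesses by a line, with s at 0 and t at 1. On it p and q are nonzero univariate
-- polynomials, so neither vanishes at a far point.
⊗-nonZero : ∀ {m} (p q : Poly m) → NonZeroPoly p → NonZeroPoly q → NonZeroPoly (p ⊗ q)
⊗-nonZero {m} p q (s , ps≢0) (t , qt≢0) = (λ j → ℓ j at K) ,
  *-≢0 (proj₁ large ∘ trans (restrict-at p ℓ K)) (proj₂ large ∘ trans (restrict-at q ℓ K))
  where
  ℓ : Fin m → List ℚ
  ℓ j = s j ∷ (t j - s j) ∷ []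
  ℓ-0 : ∀ j → ℓ j at 0ℚ ≡ s j
  ℓ-0 j = solve 2 (λ s t → s :+ κ 0ℚ :* (t :- s :+ κ 0ℚ :* κ 0ℚ) := s) refl (s j) (t j)
  ℓ-1 : ∀ j → ℓ j at 1ℚ ≡ t j
  ℓ-1 j = solve 2 (λ s t → s :+ κ 1ℚ :* (t :- s :+ κ 1ℚ :* κ 0ℚ) := t) refl (s j) (t j)
  eventually = both
    (eventually-≢0 (restrict p ℓ) {0ℚ} λ e → ps≢0 (trans (sym (eval-cong p ℓ-0)) (trans (sym (restrict-at p ℓ 0ℚ)) e)))
    (eventually-≢0 (restrict q ℓ) {1ℚ} λ e → qt≢0 (trans (sym (eval-cong q ℓ-1)) (trans (sym (restrict-at q ℓ 1ℚ)) e)))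
  -- The threshold may be negative; its absolute value is a point where both conditions hold.
  K = ∣ proj₁ eventually ∣
  large = proj₂ eventually K (subst (proj₁ eventually ℚ.≤_) (sym (∣∣p∣∣≡∣p∣ (proj₁ eventually))) (p≤∣p∣ _))

upd : ∀ {k} → (Fin (suc k) → ℚ) → ℚ → Fin (suc k) → ℚ
upd t v Fin.zero    = v
upd t v (Fin.suc j) = t (Fin.suc j)

-- Restrict P to the line through t parallel to the first axis; the restriction is nonzero at the
-- first coordinate of t.
eventually-upd-≢0 : ∀ {k} (P : Poly (suc k)) t → eval P t ≢ 0ℚ →
                    Eventually λ v → eval P (upd t v) ≢ 0ℚ
eventually-upd-≢0 {k} P t Pt≢0 = K , λ v h e →
  large v h (trans (restrict-at P ℓ v) (trans (eval-cong P (ℓ-upd v)) e))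
  where
  ℓ : Fin (suc k) → List ℚ
  ℓ Fin.zero    = 0ℚ ∷ 1ℚ ∷ []
  ℓ (Fin.suc j) = t (Fin.suc j) ∷ []
  ℓ-upd : ∀ v j → ℓ j at v ≡ upd t v j
  ℓ-upd v Fin.zero    = solve 1 (λ v → κ 0ℚ :+ v :* (κ 1ℚ :+ v :* κ 0ℚ) := v) refl v
  ℓ-upd v (Fin.suc j) = solve 2 (λ s v → s :+ v :* κ 0ℚ := s) refl (t (Fin.suc j)) v
  upd-t : ∀ j → ℓ j at t Fin.zero ≡ t j
  upd-t Fin.zero    = ℓ-upd (t Fin.zero) Fin.zero
  upd-t (Fin.suc j) = ℓ-upd (t Fin.zero) (Fin.suc j)
  eventually = eventually-≢0 (restrict P ℓ) {t Fin.zero} λ e →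
    Pt≢0 (trans (sym (eval-cong P upd-t)) (trans (sym (restrict-at P ℓ (t Fin.zero))) e))
  K = proj₁ eventually
  large = proj₂ eventually

-- Values of tuples of rational functions

value-* : ∀ {n m} (x : Tuple n m) t (d : Defined x t) k →
          value x t d k * eval (den (x k)) t ≡ eval (num (x k)) t
value-* x t d k = ÷-* _ _ (d k)

value-unique : ∀ {n m} (x : Tuple n m) t (d : Defined x t) k {v} →
               v * eval (den (x k)) t ≡ eval (num (x k)) t → value x t d k ≡ v
value-unique x t d k e = *-cancelʳ-≡ _ (d k) (trans (value-* x t d k) (sym e))

σ-cong : ∀ i {n} {x y : Fin n → ℚ} → (∀ k → x k ≡ y k) → σ i x ≡ σ i y
σ-cong zero            e = refl
σ-cong (suc i) {zero}  e = refl
σ-cong (suc i) {suc n} e =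
  cong₂ _+_ (cong₂ _*_ (e Fin.zero) (σ-cong i (e ∘ Fin.suc))) (σ-cong (suc i) (e ∘ Fin.suc))

-- Translation of the first parameter

translate : ∀ {k} → ℚ → (Fin (suc k) → ℚ) → Fin (suc k) → ℚ
translate h t = upd t (t Fin.zero + h)

translate-inverse : ∀ {k} h (t : Fin (suc k) → ℚ) j → translate h (translate (- h) t) j ≡ t j
translate-inverse h t Fin.zero    = solve 2 (λ h s → s :- h :+ h := s) refl h (t Fin.zero)
translate-inverse h t (Fin.suc j) = refl

shift : ∀ {k} → ℚ → Poly (suc k) → Poly (suc k)
shift h (con c)           = con c
shift h (var Fin.zero)    = var Fin.zero ⊕ con h
shift h (var (Fin.suc j)) = var (Fin.suc j)
shift h (p ⊕ q)           = shift h p ⊕ shift h q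
shift h (p ⊗ q)           = shift h p ⊗ shift h q
shift h (⊖ p)             = ⊖ shift h p

eval-shift : ∀ {k} h (p : Poly (suc k)) t → eval (shift h p) t ≡ eval p (translate h t)
eval-shift h (con c)           t = refl
eval-shift h (var Fin.zero)    t = refl
eval-shift h (var (Fin.suc j)) t = refl
eval-shift h (p ⊕ q)           t = cong₂ _+_ (eval-shift h p t) (eval-shift h q t)
eval-shift h (p ⊗ q)           t = cong₂ _*_ (eval-shift h p t) (eval-shift h q t)
eval-shift h (⊖ p)             t = cong -_ (eval-shift h p t)

eval-shift⁻ : ∀ {k} h (p : Poly (suc k)) t → eval (shift h p) (translate (- h) t) ≡ eval p t
eval-shift⁻ h p t = trans (eval-shift h p _) (eval-cong p (translate-inverse h t))

shiftᴿ : ∀ {k} → ℚ → RatFun (suc k) → RatFun (suc k)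
shiftᴿ h f = shift h (num f) ∕ shift h (den f) ⟨ translate (- h) (proj₁ (den≢0 f)) ,
  (λ e → proj₂ (den≢0 f) (trans (sym (eval-shift⁻ h (den f) _)) e)) ⟩

-- The shifted tuple takes at t the values of x at the translate of t, so identities carry over.
SolvesSystem-shift : ∀ {n k} i a b (x : Tuple n (suc k)) h →
                     SolvesSystem i a b x → SolvesSystem i a b (shiftᴿ h ∘ x)
SolvesSystem-shift {n} i a b x h solves t d =
  trans (σ-cong i same) (proj₁ (solves _ d′)) , trans (σ-cong n same) (proj₂ (solves _ d′))
  where
  d′ : Defined x (translate h t)
  d′ j e = d j (trans (eval-shift h (den (x j)) t) e)
  same : ∀ j → value (shiftᴿ h ∘ x) t d j ≡ value x (translate h t) d′ j
  same j = value-unique (shiftᴿ h ∘ x) t d j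
    (trans (cong (value x (translate h t) d′ j *_) (eval-shift h (den (x j)) t))
    (trans (value-* x _ d′ j) (sym (eval-shift h (num (x j)) t))))

-- Translate back the point that `indep` supplies: the shifted functions have the same values there.
AlgIndep-shift : ∀ {k} (f : Fin (suc k) → RatFun (suc k)) h → AlgIndep f → AlgIndep (shiftᴿ h ∘ f)
AlgIndep-shift f h indep P P≢0 with indep P P≢0
... | t , d , Pt≢0 = translate (- h) t , d′ , λ e → Pt≢0 (trans (eval-cong P (sym ∘ same)) e)
  where
  d′ : Defined (shiftᴿ h ∘ f) (translate (- h) t)
  d′ j e = d j (trans (sym (eval-shift⁻ h (den (f j)) t)) e)
  same : ∀ j → value (shiftᴿ h ∘ f) (translate (- h) t) d′ j ≡ value f t d j
  same j = value-unique (shiftᴿ h ∘ f) (translate (- h) t) d′ j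
    (trans (cong (value f t d j *_) (eval-shift⁻ h (den (f j)) t))
    (trans (value-* f t d j) (sym (eval-shift⁻ h (num (f j)) t))))

-- From one solution with an unbounded coordinate to infinitely many

Conclusion : (n k i : ℕ) (a b : ℚ) → Set
Conclusion n k i a b = Σ (ℕ → Tuple n (suc k)) λ x →
  (∀ j → SolvesSystem i a b (x j) × DependsOnAll (x j)) ×
  (∀ j j' → j ≢ j' → ¬ (x j ≈ᵀ x j'))

infix 4 _·∣_∣≤∣_∣
-- The cross-multiplied form of M ≤ |n / d|, which can be stated without a proof that d ≠ 0.
_·∣_∣≤∣_∣ : ℚ → ℚ → ℚ → Set
M ·∣ d ∣≤∣ n ∣ = M * ∣ d ∣ ℚ.≤ ∣ n ∣

÷-large : ∀ {M n} d (d≢0 : d ≢ 0ℚ) → M ·∣ d ∣≤∣ n ∣ → M ℚ.≤ ∣ (n ÷ d) {{≢-nonZero d≢0}} ∣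
÷-large {M} {n} d d≢0 h = *-cancelʳ-≤-pos (∣ d ∣) {{positive (0<∣p∣ d≢0)}}
  (≤-trans h (≤-reflexive (trans (cong ∣_∣ (sym (÷-* n d d≢0))) (∣p*q∣≡∣p∣*∣q∣ ((n ÷ d) {{≢-nonZero d≢0}}) d))))

-- The common interface of the three constructions. All chosen coordinates but the first are
-- parameters themselves, and the first, `f`, becomes arbitrarily large when only the first
-- parameter moves. This growth is demanded only where `C` does not vanish.
record UnboundedSolution (n k i : ℕ) (a b : ℚ) : Set where
  field
    x       : Tuple n (suc k)
    solves  : SolvesSystem i a b x
    c       : Fin (suc k) → Fin n
    c-inj   : ∀ j j' → c j ≡ c j' → j ≡ j'
    num-var : ∀ j t → eval (num (x (c (Fin.suc j)))) t ≡ t (Fin.suc j)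
    den-1   : ∀ j t → eval (den (x (c (Fin.suc j)))) t ≡ 1ℚ
    C       : Poly (suc k)
    C≢0     : NonZeroPoly C
  f : RatFun (suc k)
  f = x (c Fin.zero)
  field
    unbounded : ∀ t → eval C t ≢ 0ℚ → ∀ M → ∃ λ v →
      eval (den f) (upd t v) ≢ 0ℚ × M ·∣ eval (den f) (upd t v) ∣≤∣ eval (num f) (upd t v) ∣

module _ {n k i a b} (S : UnboundedSolution n k i a b) where
  open UnboundedSolution S

  -- Take t where neither C nor P vanishes. With the other coordinates kept, P is nonzero once its
  -- first argument w is large, and moving the first parameter gives `f` such a value w.
  algIndep : AlgIndep (x ∘ c)
  algIndep P P≢0 = upd t v , d , λ e →
    proj₂ eventually w (÷-large (eval (den f) (upd t v)) D≢0 (proj₂ (proj₂ exceeds)))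
      (trans (eval-cong P (sym ∘ same)) e)
    where
    CP≢0 = ⊗-nonZero C P C≢0 P≢0
    t = proj₁ CP≢0
    eventually = eventually-upd-≢0 P t (≢0-factorʳ (eval C t) (proj₂ CP≢0))
    exceeds = unbounded t (≢0-factorˡ (eval C t) (proj₂ CP≢0)) (proj₁ eventually)
    v = proj₁ exceeds
    D≢0 = proj₁ (proj₂ exceeds)
    d : Defined (x ∘ c) (upd t v)
    d Fin.zero      = D≢0
    d (Fin.suc j) e = 1≢0 (trans (sym (den-1 j _)) e)
    w : ℚ
    w = value (x ∘ c) (upd t v) d Fin.zero
    same : ∀ j → value (x ∘ c) (upd t v) d j ≡ upd t w j
    same Fin.zero    = refl
    same (Fin.suc j) = value-unique (x ∘ c) (upd t v) d (Fin.suc j)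
      (trans (cong (t (Fin.suc j) *_) (den-1 j _)) (trans (*-identityʳ _) (sym (num-var j _))))

  private
    t = proj₁ C≢0

    N D : ℚ → ℚ
    N v = eval (num f) (upd t v)
    D v = eval (den f) (upd t v)

    Parameter : Set
    Parameter = ∃ λ v → D v ≢ 0ℚ

    val : Parameter → ℚ
    val (v , Dv≢0) = (N v ÷ D v) {{≢-nonZero Dv≢0}}

    larger : ∀ M → ∃ λ (p : Parameter) → M ℚ.≤ ∣ val p ∣
    larger M with v , Dv≢0 , MD≤N ← unbounded t (proj₂ C≢0) M = (v , Dv≢0) , ÷-large (D v) Dv≢0 MD≤N

    -- Each value of `f` exceeds the previous one by at least 1 in absolute value, which makes the
    -- values, and later the translates, distinct.
    param : ℕ → Parameter
    param zero    = proj₁ (larger 0ℚ)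
    param (suc j) = proj₁ (larger (∣ val (param j) ∣ + 1ℚ))

    val-step : ∀ j → ∣ val (param j) ∣ ℚ.< ∣ val (param (suc j)) ∣
    val-step j = <-≤-trans p<p+1 (proj₂ (larger (∣ val (param j) ∣ + 1ℚ)))
      where
      p<p+1 : ∀ {p} → p ℚ.< p + 1ℚ
      p<p+1 {p} = subst (ℚ._< p + 1ℚ) (+-identityʳ p) (+-monoʳ-< p (positive⁻¹ 1ℚ))

    val-mono : ∀ {j j'} → j ℕ.<′ j' → ∣ val (param j) ∣ ℚ.< ∣ val (param j') ∣
    val-mono {j} ℕ.≤′-refl             = val-step j
    val-mono {j} (ℕ.≤′-step {j'} j<j') = <-trans (val-mono j<j') (val-step j')

    val-injective : ∀ j j' → j ≢ j' → val (param j) ≢ val (param j')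
    val-injective j j' j≢j' e with ℕ.<-cmp j j'
    ... | tri< j<j' _ _ = <⇒≢ (val-mono (ℕ.≤⇒≤′ j<j')) (cong ∣_∣ e)
    ... | tri≈ _ j≡j' _ = j≢j' j≡j'
    ... | tri> _ _ j'<j = <⇒≢ (val-mono (ℕ.≤⇒≤′ j'<j)) (cong ∣_∣ (sym e))

    shifted : ∀ p v → eval (shift v p) (upd t 0ℚ) ≡ eval p (upd t v)
    shifted p v = trans (eval-shift v p _) (eval-cong p λ { Fin.zero → +-identityˡ v ; (Fin.suc j) → refl })

    -- At first coordinate 0 the translate by v takes the value of `f` at first coordinate v.
    -- Evaluating the identity there compares the two values.
    same-value : ∀ p q → shiftᴿ (proj₁ p) f ≈ᴿ shiftᴿ (proj₁ q) f → val p ≡ val q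
    same-value p@(v , Dv≢0) q@(w , Dw≢0) e = *-cancelʳ-≡ _ (*-≢0 Dv≢0 Dw≢0) (begin
      val p * (D v * D w)   ≡⟨ *-assoc (val p) _ _ ⟨
      val p * D v * D w     ≡⟨ cong (_* D w) (÷-* (N v) (D v) Dv≢0) ⟩
      N v * D w             ≡⟨ cong₂ _*_ (shifted (num f) v) (shifted (den f) w) ⟨
      _                     ≡⟨ e (upd t 0ℚ) ⟩
      _                     ≡⟨ cong₂ _*_ (shifted (num f) w) (shifted (den f) v) ⟩
      N w * D v             ≡⟨ cong (_* D v) (÷-* (N w) (D w) Dw≢0) ⟨
      val q * D w * D v     ≡⟨ *-assoc (val q) _ _ ⟩
      val q * (D w * D v)   ≡⟨ cong (val q *_) (*-comm (D w) (D v)) ⟩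
      val q * (D v * D w)   ∎)
      where open ≡-Reasoning

  infinitely-many : Conclusion n k i a b
  infinitely-many = (λ j → shiftᴿ (proj₁ (param j)) ∘ x)
    , (λ j → SolvesSystem-shift i a b x _ solves
           , c , c-inj , AlgIndep-shift (x ∘ c) _ algIndep)
    , λ j j' j≢j' e → val-injective j j' j≢j' (same-value (param j) (param j') (e (c Fin.zero)))

-- Elementary symmetric polynomials: expansions and test points

pattern 0F = Fin.zero
pattern 1F = Fin.suc Fin.zero
pattern 2F = Fin.suc (Fin.suc Fin.zero)
pattern 3F = Fin.suc (Fin.suc (Fin.suc Fin.zero))
pattern 3F+ k = Fin.suc (Fin.suc (Fin.suc k))
pattern 4F+ k = Fin.suc (Fin.suc (Fin.suc (Fin.suc k)))

-- This is σ with index i - 1, under the convention that σ of index -1 is 0; it lets the coefficient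
-- α of xyz exist also for i = 2.
σ⁻ : (i : ℕ) {n : ℕ} → (Fin n → ℚ) → ℚ
σ⁻ zero    x = 0ℚ
σ⁻ (suc i) x = σ i x

σᴾ : (i : ℕ) {n m : ℕ} → (Fin n → Poly m) → Poly m
σᴾ zero    x         = con 1ℚ
σᴾ (suc i) {zero}  x = con 0ℚ
σᴾ (suc i) {suc n} x = x 0F ⊠ σᴾ i (x ∘ Fin.suc) ⊞ σᴾ (suc i) (x ∘ Fin.suc)

σ⁻ᴾ : (i : ℕ) {n m : ℕ} → (Fin n → Poly m) → Poly m
σ⁻ᴾ zero    x = con 0ℚ
σ⁻ᴾ (suc i) x = σᴾ i x

eval-σᴾ : ∀ i {n m} (x : Fin n → Poly m) t → eval (σᴾ i x) t ≡ σ i (λ k → eval (x k) t)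
eval-σᴾ zero    x         t = refl
eval-σᴾ (suc i) {zero}  x t = refl
eval-σᴾ (suc i) {suc n} x t = cong₂ (λ p q → eval (x 0F) t * p + q)
  (eval-σᴾ i (x ∘ Fin.suc) t) (eval-σᴾ (suc i) (x ∘ Fin.suc) t)

eval-σ⁻ᴾ : ∀ i {n m} (x : Fin n → Poly m) t → eval (σ⁻ᴾ i x) t ≡ σ⁻ i (λ k → eval (x k) t)
eval-σ⁻ᴾ zero    x t = refl
eval-σ⁻ᴾ (suc i) x t = eval-σᴾ i x t

σ⁻-cong : ∀ i {n} {x y : Fin n → ℚ} → (∀ k → x k ≡ y k) → σ⁻ i x ≡ σ⁻ i y
σ⁻-cong zero    e = refl
σ⁻-cong (suc i) e = σ-cong i e

σ-vanish : ∀ {n} i (x : Fin n → ℚ) → n ℕ.< i → σ i x ≡ 0ℚ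
σ-vanish {zero}  (suc i) x _         = refl
σ-vanish {suc n} (suc i) x (s≤s n<i) = trans
  (cong₂ (λ p q → x 0F * p + q) (σ-vanish i _ n<i) (σ-vanish (suc i) _ (ℕ.m<n⇒m<1+n n<i)))
  (solve 1 (λ x → x :* κ 0ℚ :+ κ 0ℚ := κ 0ℚ) refl (x 0F))

-- At j ones followed by zeros σ_l is the binomial coefficient of j over l, provided j ≤ n. So one
-- point gives σ_j = 1 and kills every σ_l with l > j.
indicator : ℕ → ∀ {n} → Fin n → ℚ
indicator zero    _           = 0ℚ
indicator (suc j) Fin.zero    = 1ℚ
indicator (suc j) (Fin.suc k) = indicator j k

σ-indicator-> : ∀ {n} i j → j ℕ.< i → σ i (indicator j {n}) ≡ 0ℚ
σ-indicator-> {zero}  (suc i) j       _         = refl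
σ-indicator-> {suc n} (suc i) zero    _         = trans
  (cong (λ q → 0ℚ * σ i (indicator 0 {n}) + q) (σ-indicator-> {n} (suc i) zero (s≤s z≤n)))
  (solve 1 (λ x → κ 0ℚ :* x :+ κ 0ℚ := κ 0ℚ) refl (σ i (indicator 0 {n})))
σ-indicator-> {suc n} (suc i) (suc j) (s≤s j<i) =
  cong₂ (λ p q → 1ℚ * p + q) (σ-indicator-> {n} i j j<i) (σ-indicator-> {n} (suc i) j (ℕ.m<n⇒m<1+n j<i))

σ-indicator : ∀ {n} j → j ℕ.≤ n → σ j (indicator j {n}) ≡ 1ℚ
σ-indicator zero            _         = refl
σ-indicator {suc n} (suc j) (s≤s j≤n) =
  cong₂ (λ p q → 1ℚ * p + q) (σ-indicator {n} j j≤n) (σ-indicator-> {n} (suc j) j ℕ.≤-refl)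

-- Sort the monomials by how many of the first three variables they contain.
σ-split₃ : ∀ j {m} (x : Fin (3 ℕ.+ m) → ℚ) {α β γ δ} →
  let u = λ k → x (3F+ k) in
  σ⁻ j u ≡ α → σ j u ≡ β → σ (1 ℕ.+ j) u ≡ γ → σ (2 ℕ.+ j) u ≡ δ →
  σ (2 ℕ.+ j) x ≡ α * (x 0F * x 1F * x 2F) + β * (x 0F * x 1F + x 0F * x 2F + x 1F * x 2F)
                + γ * (x 0F + x 1F + x 2F) + δ
-- The recursion of `σ` stops at index zero, so the constants 0 and 1 stand for α and β.
σ-split₃ zero x refl refl refl refl = solve 5
  (λ x y z γ δ → x :* (y :* κ 1ℚ :+ (z :* κ 1ℚ :+ γ)) :+ (y :* (z :* κ 1ℚ :+ γ) :+ (z :* γ :+ δ))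
    := κ 0ℚ :* (x :* y :* z) :+ κ 1ℚ :* (x :* y :+ x :* z :+ y :* z) :+ γ :* (x :+ y :+ z) :+ δ)
  refl (x 0F) (x 1F) (x 2F) (σ 1 (λ k → x (3F+ k))) (σ 2 (λ k → x (3F+ k)))
σ-split₃ (suc j) x refl refl refl refl = solve 7
  (λ x y z α β γ δ → x :* (y :* (z :* α :+ β) :+ (z :* β :+ γ)) :+ (y :* (z :* β :+ γ) :+ (z :* γ :+ δ))
    := α :* (x :* y :* z) :+ β :* (x :* y :+ x :* z :+ y :* z) :+ γ :* (x :+ y :+ z) :+ δ)
  refl (x 0F) (x 1F) (x 2F) (σ j u) (σ (1 ℕ.+ j) u) (σ (2 ℕ.+ j) u) (σ (3 ℕ.+ j) u)
  where u = λ k → x (3F+ k)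

-- In the expansion only α survives: the other coefficients have degree above the number m of
-- remaining variables.
σ-top₃ : ∀ {m} (x : Fin (3 ℕ.+ m) → ℚ) {U} → σ m (λ k → x (3F+ k)) ≡ U →
         σ (3 ℕ.+ m) x ≡ U * (x 0F * x 1F * x 2F)
σ-top₃ {m} x {U} e = trans
  (σ-split₃ (suc m) x e (σ-vanish _ _ (ℕ.n<1+n m)) (σ-vanish _ _ (ℕ.m≤n+m (suc m) 1)) (σ-vanish _ _ (ℕ.m≤n+m (suc m) 2)))
  (solve 4 (λ x y z U → U :* (x :* y :* z) :+ κ 0ℚ :* (x :* y :+ x :* z :+ y :* z) :+ κ 0ℚ :* (x :+ y :+ z) :+ κ 0ℚ
      := U :* (x :* y :* z)) refl (x 0F) (x 1F) (x 2F) U)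

-- The case 2 ≤ i ≤ n − 2

-- Put B = b / U, c = γ / β and A = (a − δ − α B) / β.  The curve xy + xz + yz + c (x + y + z) = A, xyz = B
-- is a cubic in the coordinates x and 1 / y; its tangent at (x, y) = (0, −c) leads to (c E / D, −B D / (c² G), −c G / E) with
-- E = B − c³, D = B + 2c³ + A c, G = D + E.  Below, D, E and G are multiplied by U β³.
module Curve (a b α β γ δ U D E x y z : ℚ)
  (D-def : D ≡ b * β * β * β + (γ * γ * γ * U + γ * γ * γ * U) + (a * U - δ * U - α * b) * γ * β)
  (E-def : E ≡ b * β * β * β - γ * γ * γ * U)
  (x≢0 : β * D ≢ 0ℚ) (y≢0 : β * U * γ * γ * (D + E) ≢ 0ℚ) (z≢0 : β * E ≢ 0ℚ)
  (x-eq : x * (β * D) ≡ γ * E)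
  (y-eq : y * (β * U * γ * γ * (D + E)) ≡ - (b * β * β * β * D))
  (z-eq : z * (β * E) ≡ - (γ * (D + E)))
  where
  open ≡-Reasoning

  private
    G = D + E

  product : U * (x * y * z) ≡ b
  product = *-cancelʳ-≡ _ (*-≢0 (*-≢0 x≢0 y≢0) z≢0) (begin
    U * (x * y * z) * (dx * dy * dz)
      ≡⟨ solve 7 (λ U x y z d e f → U :* (x :* y :* z) :* (d :* e :* f) := U :* ((x :* d) :* (y :* e) :* (z :* f)))
           refl U x y z dx dy dz ⟩
    U * ((x * dx) * (y * dy) * (z * dz))
      ≡⟨ cong (U *_) (cong₂ _*_ (cong₂ _*_ x-eq y-eq) z-eq) ⟩
    U * (γ * E * - (b * β * β * β * D) * - (γ * G))
      ≡⟨ solve 7 (λ U γ β b E D G → U :* (γ :* E :* (:- (b :* β :* β :* β :* D)) :* (:- (γ :* G)))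
                  := b :* (β :* D :* (β :* U :* γ :* γ :* G) :* (β :* E))) refl U γ β b E D G ⟩
    b * (dx * dy * dz) ∎)
    where
    dx = β * D
    dy = β * U * γ * γ * G
    dz = β * E

  private
    -- After scaling the unknowns by β, the equation for σ_i becomes an identity in γ, U, D and E.
    X = β * x
    Y = β * y
    Z = β * z

    -- By the definitions of D and E the right side is (a U - δ U - α b) γ β. The terms with α and δ
    -- are restored in `symmetric`.
    scaled : U * γ * (X * Y + X * Z + Y * Z) + U * γ * γ * (X + Y + Z)
             ≡ D - E - (γ * γ * γ * U + γ * γ * γ * U + γ * γ * γ * U)
    scaled = *-cancelʳ-≡ _ (*-≢0 (*-≢0 (≢0-factorʳ β x≢0) W≢0) (≢0-factorʳ β z≢0)) (begin
      _ ≡⟨ solve 8 (λ γ U X Y Z d e f →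
             (U :* γ :* (X :* Y :+ X :* Z :+ Y :* Z) :+ U :* γ :* γ :* (X :+ Y :+ Z)) :* (d :* e :* f)
             := U :* γ :* ((X :* d) :* (Y :* e) :* f :+ (X :* d) :* (Z :* f) :* e :+ (Y :* e) :* (Z :* f) :* d)
                :+ U :* γ :* γ :* ((X :* d) :* e :* f :+ (Y :* e) :* d :* f :+ (Z :* f) :* d :* e))
             refl γ U X Y Z D W E ⟩
      rhs (X * D) (Y * W) (Z * E) ≡⟨ cong₂ (λ p q → rhs p q (Z * E)) X-eq Y-eq ⟩
      rhs (γ * E) (- (H * D)) (Z * E) ≡⟨ cong (rhs (γ * E) (- (H * D))) Z-eq ⟩
      rhs (γ * E) (- (H * D)) (- (γ * G)) ≡⟨ solve 4 (λ γ U D E →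
        let G = D :+ E; H = E :+ γ :* γ :* γ :* U; W = U :* γ :* γ :* G
            p = γ :* E; q = :- (H :* D); r = :- (γ :* G)
            c = γ :* γ :* γ :* U in
        U :* γ :* (p :* q :* E :+ p :* r :* W :+ q :* r :* D)
          :+ U :* γ :* γ :* (p :* W :* E :+ q :* D :* E :+ r :* D :* W)
        := (D :- E :- (c :+ c :+ c)) :* (D :* W :* E)) refl γ U D E ⟩
      _ ∎)
      where
      -- By `E-def` this is b β³; in this form neither b nor β enters the polynomial identity.
      H = E + γ * γ * γ * U
      W = U * γ * γ * G
      rhs : ℚ → ℚ → ℚ → ℚ
      rhs p q r = U * γ * (p * q * E + p * r * W + q * r * D) + U * γ * γ * (p * W * E + q * D * E + r * D * W)
      βW : β * U * γ * γ * G ≡ β * W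
      βW = solve 4 (λ β U γ G → β :* U :* γ :* γ :* G := β :* (U :* γ :* γ :* G)) refl β U γ G
      W≢0 : W ≢ 0ℚ
      W≢0 = ≢0-factorʳ β (subst (_≢ 0ℚ) βW y≢0)
      swap : ∀ p q → β * p * q ≡ p * (β * q)
      swap p q = solve 3 (λ β p q → β :* p :* q := p :* (β :* q)) refl β p q
      X-eq : X * D ≡ γ * E
      X-eq = trans (swap x D) x-eq
      Z-eq : Z * E ≡ - (γ * G)
      Z-eq = trans (swap z E) z-eq
      Y-eq : Y * W ≡ - (H * D)
      Y-eq = trans (swap y W) (trans (cong (y *_) (sym βW)) (trans y-eq (trans
        (solve 5 (λ b β γ U D → :- (b :* β :* β :* β :* D)
           := :- ((b :* β :* β :* β :- γ :* γ :* γ :* U :+ γ :* γ :* γ :* U) :* D)) refl b β γ U D)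
        (cong (λ E → - ((E + γ * γ * γ * U) * D)) (sym E-def)))))

  symmetric : α * (x * y * z) + β * (x * y + x * z + y * z) + γ * (x + y + z) + δ ≡ a
  symmetric = *-cancelʳ-≡ (γ * β * U) γβU≢0 (begin
    _ ≡⟨ solve 8 (λ α β γ δ U x y z →
           let X = β :* x; Y = β :* y; Z = β :* z in
           (α :* (x :* y :* z) :+ β :* (x :* y :+ x :* z :+ y :* z) :+ γ :* (x :+ y :+ z) :+ δ) :* (γ :* β :* U)
           := α :* γ :* β :* (U :* (x :* y :* z))
             :+ (U :* γ :* (X :* Y :+ X :* Z :+ Y :* Z) :+ U :* γ :* γ :* (X :+ Y :+ Z))
             :+ δ :* γ :* β :* U) refl α β γ δ U x y z ⟩
    _ ≡⟨ cong₂ (λ p q → α * γ * β * p + q + δ * γ * β * U) product scaled ⟩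
    _ ≡⟨ cong₂ (λ D E → α * γ * β * b + (D - E - (γ * γ * γ * U + γ * γ * γ * U + γ * γ * γ * U)) + δ * γ * β * U)
           D-def E-def ⟩
    _ ≡⟨ solve 7 (λ a b α β γ δ U →
           let c = γ :* γ :* γ :* U; h = b :* β :* β :* β
               D = h :+ (c :+ c) :+ (a :* U :- δ :* U :- α :* b) :* γ :* β in
           α :* γ :* β :* b :+ (D :- (h :- c) :- (c :+ c :+ c)) :+ δ :* γ :* β :* U := a :* (γ :* β :* U))
           refl a b α β γ δ U ⟩
    _ ∎)
    where
    γβU≢0 : γ * β * U ≢ 0ℚ
    γβU≢0 e = y≢0 (trans (solve 4 (λ β U γ G → β :* U :* γ :* γ :* G := γ :* β :* U :* (γ :* G)) refl β U γ G)
                   (trans (cong (_* (γ * G)) e) (*-zeroˡ (γ * G))))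

varᴿ : ∀ {m} → Fin m → RatFun m
varᴿ j = var j ∕ con 1ℚ ⟨ (λ _ → 0ℚ) , 1≢0 ⟩

value-var : ∀ {n m} (x : Tuple n m) t d k {j} → x k ≡ varᴿ j → value x t d k ≡ t j
value-var x t d k {j} e = value-unique x t d k
  (subst (λ f → t j * eval (den f) t ≡ eval (num f) t) (sym e) (*-identityʳ (t j)))

≡-≢0 : ∀ {p q} → p ≡ q → q ≢ 0ℚ → p ≢ 0ℚ
≡-≢0 refl q≢0 = q≢0

≢0-≡1 : ∀ {p} → p ≡ 1ℚ → p ≢ 0ℚ
≢0-≡1 e = ≡-≢0 e 1≢0

-- Here n = k + 4 and i = j + 2, so `j≤k` says i ≤ n - 2, and the m = n - 3 parameters are the free
-- unknowns.
module Middle (k j : ℕ) (j≤k : j ℕ.≤ k) (a b : ℚ) (b≢0 : b ≢ 0ℚ) where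
  private
    m = suc k
    α = σ⁻ᴾ j {m} var
    β = σᴾ j {m} var
    γ = σᴾ (1 ℕ.+ j) {m} var
    δ = σᴾ (2 ℕ.+ j) {m} var
    U = σᴾ m {m} var
    E = con b ⊠ β ⊠ β ⊠ β ⊞ (⊖ (γ ⊠ γ ⊠ γ ⊠ U))
    D = con b ⊠ β ⊠ β ⊠ β ⊞ (γ ⊠ γ ⊠ γ ⊠ U ⊞ γ ⊠ γ ⊠ γ ⊠ U)
        ⊞ (con a ⊠ U ⊞ (⊖ (δ ⊠ U)) ⊞ (⊖ (α ⊠ con b))) ⊠ γ ⊠ β
    G = D ⊞ E

    -- At this point β = 1 and γ = 0, so D and E both reduce to b and G to 2b. It serves as witness
    -- for all four of β, D, E, G.
    s : Fin m → ℚ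
    s = indicator j

    σ-var : ∀ l t → eval (σᴾ l {m} var) t ≡ σ l t
    σ-var l t = eval-σᴾ l var t

    σᴾ-nonZero : ∀ l → l ℕ.≤ m → NonZeroPoly (σᴾ l {m} var)
    σᴾ-nonZero l l≤m = indicator l , ≢0-≡1 (trans (σ-var l _) (σ-indicator l l≤m))

    β-s : eval β s ≡ 1ℚ
    β-s = trans (σ-var j s) (σ-indicator j (ℕ.m≤n⇒m≤1+n j≤k))
    γ-s : eval γ s ≡ 0ℚ
    γ-s = trans (σ-var (1 ℕ.+ j) s) (σ-indicator-> {m} _ j ℕ.≤-refl)
    U-s : eval U s ≡ 0ℚ
    U-s = trans (σ-var m s) (σ-indicator-> {m} _ j (s≤s j≤k))

    E-s : eval E s ≡ b
    E-s = lemma (eval U s) β-s γ-s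
      where
      lemma : ∀ U {β γ} → β ≡ 1ℚ → γ ≡ 0ℚ → b * β * β * β - γ * γ * γ * U ≡ b
      lemma U refl refl = solve 2
        (λ b U → b :* κ 1ℚ :* κ 1ℚ :* κ 1ℚ :- κ 0ℚ :* κ 0ℚ :* κ 0ℚ :* U := b) refl b U

    D-s : eval D s ≡ b
    D-s = lemma (eval α s) (eval δ s) (eval U s) β-s γ-s
      where
      lemma : ∀ α δ U {β γ} → β ≡ 1ℚ → γ ≡ 0ℚ →
        b * β * β * β + (γ * γ * γ * U + γ * γ * γ * U) + (a * U - δ * U - α * b) * γ * β ≡ b
      lemma α δ U refl refl = solve 5 (λ a b α δ U →
        b :* κ 1ℚ :* κ 1ℚ :* κ 1ℚ :+ (κ 0ℚ :* κ 0ℚ :* κ 0ℚ :* U :+ κ 0ℚ :* κ 0ℚ :* κ 0ℚ :* U)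
          :+ (a :* U :- δ :* U :- α :* b) :* κ 0ℚ :* κ 1ℚ := b) refl a b α δ U

    2b≢0 : b + b ≢ 0ℚ
    2b≢0 e = *-≢0 {1ℚ + 1ℚ} (λ ()) b≢0
      (trans (solve 1 (λ b → (κ 1ℚ :+ κ 1ℚ) :* b := b :+ b) refl b) e)

    E≢0 : NonZeroPoly E
    E≢0 = s , ≡-≢0 E-s b≢0
    D≢0 : NonZeroPoly D
    D≢0 = s , ≡-≢0 D-s b≢0
    G≢0 : NonZeroPoly G
    G≢0 = s , ≡-≢0 (cong₂ _+_ D-s E-s) 2b≢0
    β≢0 : NonZeroPoly β
    β≢0 = s , ≢0-≡1 β-s
    γ≢0 : NonZeroPoly γ
    γ≢0 = σᴾ-nonZero (1 ℕ.+ j) (s≤s j≤k)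
    U≢0 : NonZeroPoly U
    U≢0 = σᴾ-nonZero m ℕ.≤-refl

    x : Tuple (3 ℕ.+ m) m
    x 0F      = (γ ⊠ E) ∕ (β ⊠ D) ⟨ ⊗-nonZero β D β≢0 D≢0 ⟩
    x 1F      = (⊖ (con b ⊠ β ⊠ β ⊠ β ⊠ D)) ∕ (β ⊠ U ⊠ γ ⊠ γ ⊠ G)
      ⟨ ⊗-nonZero (β ⊠ U ⊠ γ ⊠ γ) G (⊗-nonZero (β ⊠ U ⊠ γ) γ (⊗-nonZero (β ⊠ U) γ
        (⊗-nonZero β U β≢0 U≢0) γ≢0) γ≢0) G≢0 ⟩
    x 2F      = (⊖ (γ ⊠ G)) ∕ (β ⊠ E) ⟨ ⊗-nonZero β E β≢0 E≢0 ⟩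
    x (3F+ l) = varᴿ l

    solves : SolvesSystem (2 ℕ.+ j) a b x
    solves t d =
        trans (σ-split₃ j w (trans (σ⁻-cong j tail) (sym (eval-σ⁻ᴾ j var t)))
                            (σ-tail j) (σ-tail (1 ℕ.+ j)) (σ-tail (2 ℕ.+ j)))
              symmetric
      , trans (σ-top₃ w (σ-tail m)) product
      where
      w = value x t d
      tail : ∀ l → w (3F+ l) ≡ t l
      tail l = value-var x t d (3F+ l) refl
      σ-tail : ∀ l → σ l (λ k → w (3F+ k)) ≡ eval (σᴾ l var) t
      σ-tail l = trans (σ-cong l tail) (sym (σ-var l t))
      open Curve a b (eval α t) (eval β t) (eval γ t) (eval δ t) (eval U t) (eval D t) (eval E t) (w 0F) (w 1F) (w 2F)
        refl refl
        (d 0F) (d 1F) (d 2F) (value-* x t d 0F) (value-* x t d 1F) (value-* x t d 2F)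

  solution : UnboundedSolution (3 ℕ.+ m) k (2 ℕ.+ j) a b
  solution = record
    { x = x ; solves = solves
    ; c = λ l → 3F+ l ; c-inj = λ { _ _ refl → refl }
    ; num-var = λ _ _ → refl ; den-1 = λ _ _ → refl
    ; C = con 1ℚ ; C≢0 = (λ _ → 0ℚ) , 1≢0
    -- Here `f` is the first parameter, so giving it the value M is enough.
    ; unbounded = λ t _ M → M , 1≢0 , ≤-trans (≤-reflexive (*-identityʳ M)) (p≤∣p∣ M)
    }

-- The case i = n − 1

-- The reciprocals of the unknowns have product q = U / b and sum p = C / (b U).  They are
-- p v / (v − r), (v − r) / p, −p r / (v − r) and −(v − r) / p, where r = q / v.
module Top (a b S U C F v x y z w : ℚ) (C-def : C ≡ a * U - b * S) (F-def : F ≡ b * v * v - U)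
  (x≢0 : C * v * v ≢ 0ℚ) (y≢0 : U * F ≢ 0ℚ) (z≢0 : C ≢ 0ℚ)
  (x-eq : x * (C * v * v) ≡ F * U)
  (y-eq : y * (U * F) ≡ C * v)
  (z-eq : z * C ≡ - (b * F))
  (w-eq : w * (U * F) ≡ - (C * v))
  where
  open ≡-Reasoning

  private
    w≡-y : w ≡ - y
    w≡-y = *-cancelʳ-≡ _ y≢0 (trans w-eq (trans (cong -_ (sym y-eq)) (neg-distribˡ-* y (U * F))))

    y²-eq : y * y * (U * F * (U * F)) ≡ C * v * (C * v)
    y²-eq = trans (solve 2 (λ y d → y :* y :* (d :* d) := y :* d :* (y :* d)) refl y (U * F)) (cong₂ _*_ y-eq y-eq)

    reduced-product : U * - (y * y * x * z) ≡ b
    reduced-product = *-cancelʳ-≡ _ (*-≢0 (*-≢0 (*-≢0 y≢0 y≢0) x≢0) z≢0) (begin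
      _ ≡⟨ solve 7 (λ U y x z d e f → U :* (:- (y :* y :* x :* z)) :* (d :* d :* e :* f)
             := :- (U :* (y :* y :* (d :* d)) :* (x :* e) :* (z :* f))) refl U y x z (U * F) (C * v * v) C ⟩
      _ ≡⟨ cong -_ (cong₂ _*_ (cong₂ (λ p q → U * p * q) y²-eq x-eq) z-eq) ⟩
      _ ≡⟨ solve 5 (λ U C F v b → :- (U :* (C :* v :* (C :* v)) :* (F :* U) :* (:- (b :* F)))
             := b :* (U :* F :* (U :* F) :* (C :* v :* v) :* C)) refl U C F v b ⟩
      b * (U * F * (U * F) * (C * v * v) * C) ∎)

    x+z-eq : (x + z) * (C * v * v) ≡ - (F * F)
    x+z-eq = begin
      _ ≡⟨ solve 4 (λ x z C v → (x :+ z) :* (C :* v :* v) := x :* (C :* v :* v) :+ z :* C :* v :* v) refl x z C v ⟩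
      _ ≡⟨ cong₂ (λ p q → p + q * v * v) x-eq z-eq ⟩
      _ ≡⟨ cong (λ F → F * U + - (b * F) * v * v) F-def ⟩
      _ ≡⟨ solve 3 (λ b U v → let F = b :* v :* v :- U in
             F :* U :+ (:- (b :* F)) :* v :* v := :- (F :* F)) refl b U v ⟩
      _ ≡⟨ cong (λ F → - (F * F)) F-def ⟨
      - (F * F) ∎

    -- With w = -y one has yz + yw + zw = -y², so σ_{n-1} = -S x y² z - U y² (x + z). Multiplied by
    -- U, the first term is S b; the second must be a U - b S = C.
    third : - (y * y * (x + z)) * U * U ≡ C
    third = *-cancelʳ-≡ _ (*-≢0 (*-≢0 F≢0 F≢0) x≢0) (begin
      _ ≡⟨ solve 5 (λ y p U F e → (:- (y :* y :* p)) :* U :* U :* (F :* F :* e)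
             := :- (y :* y :* (U :* F :* (U :* F)) :* (p :* e))) refl y (x + z) U F (C * v * v) ⟩
      _ ≡⟨ cong -_ (cong₂ _*_ y²-eq x+z-eq) ⟩
      _ ≡⟨ solve 3 (λ C v F → :- (C :* v :* (C :* v) :* (:- (F :* F))) := C :* (F :* F :* (C :* v :* v))) refl C v F ⟩
      C * (F * F * (C * v * v)) ∎)
      where
      F≢0 : F ≢ 0ℚ
      F≢0 = ≢0-factorʳ U y≢0

  product : x * (U * (y * z * w)) ≡ b
  product = begin
    x * (U * (y * z * w))    ≡⟨ cong (λ w → x * (U * (y * z * w))) w≡-y ⟩
    x * (U * (y * z * - y))  ≡⟨ solve 4 (λ x y z U → x :* (U :* (y :* z :* (:- y))) := U :* (:- (y :* y :* x :* z))) refl x y z U ⟩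
    U * - (y * y * x * z)    ≡⟨ reduced-product ⟩
    b                        ∎

  symmetric : x * (S * (y * z * w) + U * (y * z + y * w + z * w)) + U * (y * z * w) ≡ a
  symmetric = *-cancelʳ-≡ U (≢0-factorˡ U y≢0) (begin
    _ ≡⟨ cong (λ w → (x * (S * (y * z * w) + U * (y * z + y * w + z * w)) + U * (y * z * w)) * U) w≡-y ⟩
    _ ≡⟨ solve 5 (λ x y z S U → let w = :- y in
           (x :* (S :* (y :* z :* w) :+ U :* (y :* z :+ y :* w :+ z :* w)) :+ U :* (y :* z :* w)) :* U
           := S :* (U :* (:- (y :* y :* x :* z))) :+ (:- (y :* y :* (x :+ z))) :* U :* U) refl x y z S U ⟩
    _ ≡⟨ cong₂ (λ p q → S * p + q) reduced-product (trans third C-def) ⟩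
    _ ≡⟨ solve 4 (λ a b S U → S :* b :+ (a :* U :- b :* S) := a :* U) refl a b S U ⟩
    a * U ∎)

-- After the first variable is split off, `σ-split₃` and `σ-top₃` apply to the rest; the σ of index
-- above k in k variables vanish.
σ-split₄ : ∀ {k} (x : Fin (4 ℕ.+ k) → ℚ) {S U} →
  let u = λ l → x (4F+ l); y = x 1F; z = x 2F; w = x 3F in
  σ⁻ k u ≡ S → σ k u ≡ U →
  σ (3 ℕ.+ k) x ≡ x 0F * (S * (y * z * w) + U * (y * z + y * w + z * w)) + U * (y * z * w)
σ-split₄ {k} x {S} {U} S-eq U-eq = cong₂ (λ p q → x 0F * p + q)
  (trans (σ-split₃ k (x ∘ Fin.suc) S-eq U-eq (σ-vanish _ _ (ℕ.n<1+n k)) (σ-vanish _ _ (ℕ.m≤n+m (suc k) 1)))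
         (solve 5 (λ y z w S U → S :* (y :* z :* w) :+ U :* (y :* z :+ y :* w :+ z :* w) :+ κ 0ℚ :* (y :+ z :+ w) :+ κ 0ℚ
            := S :* (y :* z :* w) :+ U :* (y :* z :+ y :* w :+ z :* w)) refl (x 1F) (x 2F) (x 3F) S U))
  (σ-top₃ (x ∘ Fin.suc) U-eq)

σ-top₄ : ∀ {k} (x : Fin (4 ℕ.+ k) → ℚ) {U} → σ k (λ l → x (4F+ l)) ≡ U →
         σ (4 ℕ.+ k) x ≡ x 0F * (U * (x 1F * x 2F * x 3F))
σ-top₄ {k} x {U} U-eq = trans
  (cong₂ (λ p q → x 0F * p + q) (σ-top₃ (x ∘ Fin.suc) U-eq) (σ-vanish (4 ℕ.+ k) (x ∘ Fin.suc) ℕ.≤-refl))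
  (+-identityʳ _)

module LastButOne (k : ℕ) (a b : ℚ) (b≢0 : b ≢ 0ℚ) where
  private
    -- The first parameter is reserved for v, so the free unknowns start at the second.
    u : Fin k → Poly (suc k)
    u = var ∘ Fin.suc
    v = var {suc k} 0F
    S = σ⁻ᴾ k u
    U = σᴾ k u
  C : Poly (suc k)
  C = con a ⊠ U ⊞ (⊖ (con b ⊠ S))
  private
    F = con b ⊠ v ⊠ v ⊞ (⊖ U)

    extend : (Fin k → ℚ) → Fin (suc k) → ℚ
    extend s 0F          = 0ℚ
    extend s (Fin.suc l) = s l

    U≢0 : NonZeroPoly U
    U≢0 = extend (indicator k) , ≢0-≡1 (trans (eval-σᴾ k u _) (σ-indicator k ℕ.≤-refl))

    -- At v = 0 this polynomial is -U, so the witness for U, which has v = 0, serves again.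
    F≢0 : NonZeroPoly F
    F≢0 = extend (indicator k) , λ e → proj₂ U≢0
      (trans (solve 2 (λ b U → U := :- (b :* κ 0ℚ :* κ 0ℚ :- U)) refl b (eval U (extend (indicator k)))) (cong -_ e))

    v≢0 : NonZeroPoly v
    v≢0 = (λ _ → 1ℚ) , 1≢0

  module _ (C≢0 : NonZeroPoly C) where
    private
      UF≢0 = ⊗-nonZero U F U≢0 F≢0

      x : Tuple (4 ℕ.+ k) (suc k)
      x 0F      = (F ⊠ U) ∕ (C ⊠ v ⊠ v) ⟨ ⊗-nonZero (C ⊠ v) v (⊗-nonZero C v C≢0 v≢0) v≢0 ⟩
      x 1F      = (C ⊠ v) ∕ (U ⊠ F) ⟨ UF≢0 ⟩
      x 2F      = (⊖ (con b ⊠ F)) ∕ C ⟨ C≢0 ⟩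
      x 3F      = (⊖ (C ⊠ v)) ∕ (U ⊠ F) ⟨ UF≢0 ⟩
      x (4F+ l) = varᴿ (Fin.suc l)

      solves : SolvesSystem (3 ℕ.+ k) a b x
      solves t d =
          trans (σ-split₄ w (trans (σ⁻-cong k tail) (sym (eval-σ⁻ᴾ k u t))) U-eq) symmetric
        , trans (σ-top₄ w U-eq) product
        where
        w = value x t d
        tail : ∀ l → w (4F+ l) ≡ t (Fin.suc l)
        tail l = value-var x t d (4F+ l) refl
        U-eq : σ k (λ l → w (4F+ l)) ≡ eval U t
        U-eq = trans (σ-cong k tail) (sym (eval-σᴾ k u t))
        open Top a b (eval S t) (eval U t) (eval C t) (eval F t) (t 0F) (w 0F) (w 1F) (w 2F) (w 3F) refl refl
          (d 0F) (d 1F) (d 2F) (value-* x t d 0F) (value-* x t d 1F) (value-* x t d 2F) (value-* x t d 3F)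

      -- The coordinate used is -b F / C. Its denominator is free of v, while its numerator b U - b²
      -- v² is coercive in v because b ≠ 0.
      unbounded : ∀ t → eval C t ≢ 0ℚ → ∀ M → ∃ λ v →
        eval C (upd t v) ≢ 0ℚ × M ·∣ eval C (upd t v) ∣≤∣ - (b * eval F (upd t v)) ∣
      unbounded t Ct≢0 M = h , (λ e → Ct≢0 (trans (sym C-upd) e)) ,
        subst₂ (λ p q → M * ∣ p ∣ ℚ.≤ ∣ q ∣) (sym C-upd) num-eq (proj₂ large h K≤h)
        where
        large = coercive (b * eval U t) (0ℚ ∷ - (b * b) ∷ []) {1ℚ}
          (λ e → *-≢0 b≢0 b≢0 (trans (solve 1 (λ b → b :* b
             := :- (κ 0ℚ :+ κ 1ℚ :* (:- (b :* b) :+ κ 1ℚ :* κ 0ℚ))) refl b) (cong -_ e)))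
          (M * ∣ eval C t ∣)
        h : ℚ
        h = ∣ proj₁ large ∣
        K≤h : proj₁ large ℚ.≤ ∣ h ∣
        K≤h = ≤-trans (p≤∣p∣ _) (p≤∣p∣ h)
        U-upd : eval U (upd t h) ≡ eval U t
        U-upd = trans (eval-σᴾ k u _) (sym (eval-σᴾ k u t))
        C-upd : eval C (upd t h) ≡ eval C t
        C-upd = cong₂ (λ p q → a * p - b * q) U-upd (trans (eval-σ⁻ᴾ k u _) (sym (eval-σ⁻ᴾ k u t)))
        num-eq : b * eval U t + h * (0ℚ + h * (- (b * b) + h * 0ℚ)) ≡ - (b * eval F (upd t h))
        num-eq = trans (solve 3 (λ b U h → b :* U :+ h :* (κ 0ℚ :+ h :* (:- (b :* b) :+ h :* κ 0ℚ))
            := :- (b :* (b :* h :* h :- U))) refl b (eval U t) h)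
          (cong (λ p → - (b * (b * h * h - p))) (sym U-upd))

      c : Fin (suc k) → Fin (4 ℕ.+ k)
      c 0F          = 2F
      c (Fin.suc l) = 4F+ l

    solution : UnboundedSolution (4 ℕ.+ k) k (3 ℕ.+ k) a b
    solution = record
      { x = x ; solves = solves
      ; c = c ; c-inj = λ { 0F 0F _ → refl ; (Fin.suc _) (Fin.suc _) refl → refl }
      ; num-var = λ _ _ → refl ; den-1 = λ _ _ → refl
      ; C = C ; C≢0 = C≢0
      ; unbounded = unbounded
      }

  -- Give the free unknowns k - 1 ones and a single zero: then U = 0 and S = 1, hence C = -b.
  C-nonZero : ∀ {k′} → k ≡ suc k′ → NonZeroPoly C
  C-nonZero {k′} refl = extend s , λ e → b≢0 (begin
    b                          ≡⟨ solve 2 (λ a b → b := :- (a :* κ 0ℚ :- b :* κ 1ℚ)) refl a b ⟩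
    - (a * 0ℚ - b * 1ℚ)        ≡⟨ cong -_ (cong₂ (λ p q → a * p - b * q) U-s S-s) ⟨
    - (eval C (extend s))      ≡⟨ cong -_ e ⟩
    0ℚ                         ∎)
    where
    open ≡-Reasoning
    s : Fin k → ℚ
    s = indicator k′
    U-s : eval U (extend s) ≡ 0ℚ
    U-s = trans (eval-σᴾ k u (extend s)) (σ-indicator-> {k} k k′ ℕ.≤-refl)
    S-s : eval S (extend s) ≡ 1ℚ
    S-s = trans (eval-σᴾ k′ u (extend s)) (σ-indicator {k} k′ (ℕ.n≤1+n k′))

-- The case n = 4, i = 3, a = 0

_/1 : ℕ → ℚ
n /1 = ℤ.+ n ℚ./ 1

-- For a = 0 the reciprocals have sum zero. With the fourth one -(X + Y + Z), the product condition
-- reads XYZ (X + Y + Z) = -1/b = e, and the reciprocals of x, y, z are Euler's solution in terms of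
-- τ = e v⁴.
module Euler (b e v P Q R x y z w : ℚ) (eb≡-1 : e * b ≡ - 1ℚ)
  (P-def : P ≡ 4 /1 * (e * (v * v * v * v)) + 1ℚ) (Q-def : Q ≡ e * (v * v * v * v) - 2 /1)
  (R-def : R ≡ 2 /1 * (e * (v * v * v * v)) * (e * (v * v * v * v)) + 10 /1 * (e * (v * v * v * v)) - 1ℚ)
  (x≢0 : 6 /1 * e * v * v * v * Q * Q ≢ 0ℚ) (y≢0 : 3 /1 * P * P ≢ 0ℚ)
  (z≢0 : 2 /1 * R ≢ 0ℚ) (w≢0 : R ≢ 0ℚ)
  (x-eq : x * (6 /1 * e * v * v * v * Q * Q) ≡ P * R)
  (y-eq : y * (3 /1 * P * P) ≡ 2 /1 * v * Q * R)
  (z-eq : z * (2 /1 * R) ≡ 3 /1 * v * P)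
  (w-eq : w * R ≡ - (6 /1 * v * Q))
  where
  open ≡-Reasoning

  private
    τ = e * (v * v * v * v)
    d₀ = 6 /1 * e * v * v * v * Q * Q
    d₁ = 3 /1 * P * P
    d₂ = 2 /1 * R
    n₀ = P * R
    n₁ = 2 /1 * v * Q * R
    n₂ = 3 /1 * v * P
    n₃ = - (6 /1 * v * Q)

    d≢0 : d₀ * d₁ * d₂ * R ≢ 0ℚ
    d≢0 = *-≢0 (*-≢0 (*-≢0 x≢0 y≢0) z≢0) w≢0

    -- The sum of 9 (4 τ Q³ + P³ − R²) = 0 and (9 + 4 Q − P) R² = 0.
    identity : 36 /1 * τ * Q * Q * Q + 9 /1 * P * P * P + (4 /1 * Q - P) * R * R ≡ 0ℚ
    identity = trans (cong₃ P-def Q-def R-def) (solve 1 (λ τ →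
      let P = κ (4 /1) :* τ :+ κ 1ℚ; Q = τ :- κ (2 /1); R = κ (2 /1) :* τ :* τ :+ κ (10 /1) :* τ :- κ 1ℚ in
      κ (36 /1) :* τ :* Q :* Q :* Q :+ κ (9 /1) :* P :* P :* P :+ (κ (4 /1) :* Q :- P) :* R :* R := κ 0ℚ) refl τ)
      where
      cong₃ : ∀ {P P′ Q Q′ R R′} → P ≡ P′ → Q ≡ Q′ → R ≡ R′ →
        36 /1 * τ * Q * Q * Q + 9 /1 * P * P * P + (4 /1 * Q - P) * R * R ≡
        36 /1 * τ * Q′ * Q′ * Q′ + 9 /1 * P′ * P′ * P′ + (4 /1 * Q′ - P′) * R′ * R′
      cong₃ refl refl refl = refl

  product : x * (1ℚ * (y * z * w)) ≡ b
  product = *-cancelʳ-≡ _ d≢0 (begin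
    _ ≡⟨ solve 8 (λ x y z w d e f g → x :* (κ 1ℚ :* (y :* z :* w)) :* (d :* e :* f :* g)
           := x :* d :* (y :* e) :* (z :* f) :* (w :* g)) refl x y z w d₀ d₁ d₂ R ⟩
    _ ≡⟨ cong₂ _*_ (cong₂ _*_ (cong₂ _*_ x-eq y-eq) z-eq) w-eq ⟩
    _ ≡⟨ solve 4 (λ v P Q R →
           P :* R :* (κ (2 /1) :* v :* Q :* R) :* (κ (3 /1) :* v :* P) :* (:- (κ (6 /1) :* v :* Q))
           := κ (- 1ℚ) :* (κ (36 /1) :* v :* v :* v :* Q :* Q :* P :* P :* R :* R)) refl v P Q R ⟩
    _ ≡⟨ cong (_* (36 /1 * v * v * v * Q * Q * P * P * R * R)) eb≡-1 ⟨
    _ ≡⟨ solve 6 (λ b e v P Q R → e :* b :* (κ (36 /1) :* v :* v :* v :* Q :* Q :* P :* P :* R :* R)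
           := b :* (κ (6 /1) :* e :* v :* v :* v :* Q :* Q :* (κ (3 /1) :* P :* P) :* (κ (2 /1) :* R) :* R))
           refl b e v P Q R ⟩
    b * (d₀ * d₁ * d₂ * R) ∎)

  symmetric : x * (0ℚ * (y * z * w) + 1ℚ * (y * z + y * w + z * w)) + 1ℚ * (y * z * w) ≡ 0ℚ
  symmetric = *-cancelʳ-≡ _ d≢0 (begin
    _ ≡⟨ solve 8 (λ x y z w d e f g →
           (x :* (κ 0ℚ :* (y :* z :* w) :+ κ 1ℚ :* (y :* z :+ y :* w :+ z :* w)) :+ κ 1ℚ :* (y :* z :* w)) :* (d :* e :* f :* g)
           := (x :* d) :* (y :* e) :* (z :* f) :* g :+ (x :* d) :* (y :* e) :* (w :* g) :* f
             :+ (x :* d) :* (z :* f) :* (w :* g) :* e :+ (y :* e) :* (z :* f) :* (w :* g) :* d)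
           refl x y z w d₀ d₁ d₂ R ⟩
    _ ≡⟨ cong₄ x-eq y-eq z-eq w-eq ⟩
    n₀ * n₁ * n₂ * R + n₀ * n₁ * n₃ * d₂ + n₀ * n₂ * n₃ * d₁ + n₁ * n₂ * n₃ * d₀
      ≡⟨ solve 5 (λ e v P Q R →
           let p = P :* R; q = κ (2 /1) :* v :* Q :* R; r = κ (3 /1) :* v :* P; s = :- (κ (6 /1) :* v :* Q)
               τ = e :* (v :* v :* v :* v) in
           p :* q :* r :* R :+ p :* q :* s :* (κ (2 /1) :* R) :+ p :* r :* s :* (κ (3 /1) :* P :* P)
             :+ q :* r :* s :* (κ (6 /1) :* e :* v :* v :* v :* Q :* Q)
           := κ (- (6 /1)) :* v :* v :* P :* Q :* R :* (κ (36 /1) :* τ :* Q :* Q :* Q :+ κ (9 /1) :* P :* P :* P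
                 :+ (κ (4 /1) :* Q :- P) :* R :* R)) refl e v P Q R ⟩
    _ ≡⟨ cong (- (6 /1) * v * v * P * Q * R *_) identity ⟩
    - (6 /1) * v * v * P * Q * R * 0ℚ
      ≡⟨ trans (*-zeroʳ (- (6 /1) * v * v * P * Q * R)) (sym (*-zeroˡ (d₀ * d₁ * d₂ * R))) ⟩
    0ℚ * (d₀ * d₁ * d₂ * R) ∎)
    where
    cong₄ : ∀ {p p′ q q′ r r′ s s′} → p ≡ p′ → q ≡ q′ → r ≡ r′ → s ≡ s′ →
      p * q * r * R + p * q * s * d₂ + p * r * s * d₁ + q * r * s * d₀ ≡
      p′ * q′ * r′ * R + p′ * q′ * s′ * d₂ + p′ * r′ * s′ * d₁ + q′ * r′ * s′ * d₀
    cong₄ refl refl refl refl = refl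

module Four (b : ℚ) (b≢0 : b ≢ 0ℚ) where
  private
    e : ℚ
    e = - (1/ b) {{≢-nonZero b≢0}}

    eb≡-1 : e * b ≡ - 1ℚ
    eb≡-1 = trans (sym (neg-distribˡ-* ((1/ b) {{≢-nonZero b≢0}}) b)) (cong -_ (*-inverseˡ b {{≢-nonZero b≢0}}))

    e≢0 : e ≢ 0ℚ
    e≢0 = ≢0-factorˡ e {b} (≡-≢0 eb≡-1 λ ())

    v = var {1} 0F
    τ P Q R : Poly 1
    τ = con e ⊠ (v ⊠ v ⊠ v ⊠ v)
    P = con (4 /1) ⊠ τ ⊞ con 1ℚ
    Q = τ ⊞ con (- (2 /1))
    R = con (2 /1) ⊠ τ ⊠ τ ⊞ con (10 /1) ⊠ τ ⊞ con (- 1ℚ)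

    v≢0 : NonZeroPoly v
    v≢0 = (λ _ → 1ℚ) , 1≢0

    con≢0 : ∀ {c} → c ≢ 0ℚ → NonZeroPoly {1} (con c)
    con≢0 c≢0 = (λ _ → 0ℚ) , c≢0

    P≢0 : NonZeroPoly P
    P≢0 = (λ _ → 0ℚ) , ≡-≢0 (solve 1 (λ e →
      κ (4 /1) :* (e :* κ 0ℚ) :+ κ 1ℚ := κ 1ℚ) refl e) λ ()

    Q≢0 : NonZeroPoly Q
    Q≢0 = (λ _ → 0ℚ) , ≡-≢0 (solve 1 (λ e →
      e :* κ 0ℚ :+ κ (- (2 /1)) := κ (- (2 /1))) refl e) λ ()

    R≢0 : NonZeroPoly R
    R≢0 = (λ _ → 0ℚ) , ≡-≢0 (solve 1 (λ e → let τ = e :* κ 0ℚ in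
      κ (2 /1) :* τ :* τ :+ κ (10 /1) :* τ :+ κ (- 1ℚ) := κ (- 1ℚ)) refl e) λ ()

    x : Tuple 4 1
    x 0F = (P ⊠ R) ∕ (con (6 /1) ⊠ con e ⊠ v ⊠ v ⊠ v ⊠ Q ⊠ Q)
      ⟨ ⊗-nonZero (c₆ ⊠ con e ⊠ v ⊠ v ⊠ v ⊠ Q) Q (⊗-nonZero (c₆ ⊠ con e ⊠ v ⊠ v ⊠ v) Q
        (⊗-nonZero (c₆ ⊠ con e ⊠ v ⊠ v) v (⊗-nonZero (c₆ ⊠ con e ⊠ v) v (⊗-nonZero (c₆ ⊠ con e) v
        (⊗-nonZero c₆ (con e) (con≢0 λ ()) (con≢0 e≢0)) v≢0) v≢0) v≢0) Q≢0) Q≢0 ⟩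
      where c₆ = con (6 /1)
    x 1F = (con (2 /1) ⊠ v ⊠ Q ⊠ R) ∕ (con (3 /1) ⊠ P ⊠ P)
      ⟨ ⊗-nonZero (con (3 /1) ⊠ P) P (⊗-nonZero (con (3 /1)) P (con≢0 λ ()) P≢0) P≢0 ⟩
    x 2F = (con (3 /1) ⊠ v ⊠ P) ∕ (con (2 /1) ⊠ R) ⟨ ⊗-nonZero (con (2 /1)) R (con≢0 λ ()) R≢0 ⟩
    x 3F = (⊖ (con (6 /1) ⊠ v ⊠ Q)) ∕ R ⟨ R≢0 ⟩

    solves : SolvesSystem 3 0ℚ b x
    solves t d = trans (σ-split₄ w refl refl) symmetric , trans (σ-top₄ w refl) product
      where
      w = value x t d
      open Euler b e (t 0F) (eval P t) (eval Q t) (eval R t) (w 0F) (w 1F) (w 2F) (w 3F) eb≡-1 refl refl refl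
        (d 0F) (d 1F) (d 2F) (d 3F) (value-* x t d 0F) (value-* x t d 1F) (value-* x t d 2F) (value-* x t d 3F)

    -- The expansions of Q R, P² and P in powers of τ.
    QRᴸ PPᴸ Pᴸ : List ℚ
    QRᴸ = 2 /1 ∷ - (21 /1) ∷ 6 /1 ∷ 2 /1 ∷ []
    PPᴸ = 1ℚ ∷ 8 /1 ∷ 16 /1 ∷ []
    Pᴸ  = 1ℚ ∷ 4 /1 ∷ []

    -- Degree 3 against degree 2: stripping two low coefficients from each leaves 6 + 2τ against the
    -- constant 16.
    QR-dominates : Dominates QRᴸ PPᴸ
    QR-dominates = Dominates-∷ (2 /1) 1ℚ {(- (21 /1)) ∷ 6 /1 ∷ 2 /1 ∷ []} {8 /1 ∷ 16 /1 ∷ []}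
      (Dominates-∷ (- (21 /1)) (8 /1) {6 /1 ∷ 2 /1 ∷ []} {16 /1 ∷ []}
      (Dominates-const {6 /1 ∷ 2 /1 ∷ []} (16 /1) (coercive (6 /1) (2 /1 ∷ []) {0ℚ} λ ())))

    QR-at : ∀ τ → QRᴸ at τ ≡ (τ - 2 /1) * (2 /1 * τ * τ + 10 /1 * τ - 1ℚ)
    QR-at = solve 1 (λ τ →
      κ (2 /1) :+ τ :* (κ (- (21 /1)) :+ τ :* (κ (6 /1) :+ τ :* (κ (2 /1) :+ τ :* κ 0ℚ)))
      := (τ :- κ (2 /1)) :* (κ (2 /1) :* τ :* τ :+ κ (10 /1) :* τ :- κ 1ℚ)) refl

    PP-at : ∀ τ → PPᴸ at τ ≡ (4 /1 * τ + 1ℚ) * (4 /1 * τ + 1ℚ)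
    PP-at = solve 1 (λ τ → κ 1ℚ :+ τ :* (κ (8 /1) :+ τ :* (κ (16 /1) :+ τ :* κ 0ℚ))
      := (κ (4 /1) :* τ :+ κ 1ℚ) :* (κ (4 /1) :* τ :+ κ 1ℚ)) refl

    P-at : ∀ τ → Pᴸ at τ ≡ 4 /1 * τ + 1ℚ
    P-at = solve 1 (λ τ → κ 1ℚ :+ τ :* (κ (4 /1) :+ τ :* κ 0ℚ) := κ (4 /1) :* τ :+ κ 1ℚ) refl

    h≤h⁴ : ∀ {h} → 1ℚ ℚ.≤ h → h ℚ.≤ h * h * h * h
    h≤h⁴ {h} 1≤h = subst (ℚ._≤ h * h * h * h) (*-identityˡ h)
      (*-monoʳ-≤-nonNeg h {{nonNegative (≤-trans (nonNegative⁻¹ 1ℚ) 1≤h)}}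
        (*-mono-≤ {1ℚ} {h * h} {1ℚ} {h} (nonNegative⁻¹ 1ℚ) (nonNegative⁻¹ 1ℚ)
          (*-mono-≤ {1ℚ} {h} {1ℚ} {h} (nonNegative⁻¹ 1ℚ) (nonNegative⁻¹ 1ℚ) 1≤h 1≤h) 1≤h))

    -- The coordinate x 1F grows like h⁵.
    unbounded : ∀ M → ∃ λ (h : ℚ) → let τ = e * (h * h * h * h); p = 4 /1 * τ + 1ℚ in
      (3 /1 * p * p ≢ 0ℚ) × (M ·∣ 3 /1 * p * p ∣≤∣ 2 /1 * h * (τ - 2 /1) * (2 /1 * τ * τ + 10 /1 * τ - 1ℚ) ∣)
    unbounded M = h , *-≢0 (*-≢0 {3 /1} (λ ()) p≢0) p≢0 , (begin
      M * ∣ 3 /1 * p * p ∣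
        ≤⟨ *-monoʳ-≤-nonNeg (∣ 3 /1 * p * p ∣) {{∣-∣-nonNeg (3 /1 * p * p)}} (p≤∣p∣ M) ⟩
      ∣ M ∣ * ∣ 3 /1 * p * p ∣
        ≡⟨ cong (∣ M ∣ *_) (trans (cong ∣_∣ (*-assoc (3 /1) p p)) (∣p*q∣≡∣p∣*∣q∣ (3 /1) (p * p))) ⟩
      ∣ M ∣ * (3 /1 * ∣ p * p ∣)
        ≡⟨ *-assoc (∣ M ∣) (3 /1) (∣ p * p ∣) ⟨
      N * ∣ p * p ∣
        ≤⟨ *-monoˡ-≤-nonNeg N {{nonNegative 0≤N}} (p≤p+q (nonNegative⁻¹ 1ℚ)) ⟩
      N * (∣ p * p ∣ + 1ℚ)
        ≡⟨ cong (λ s → N * (∣ s ∣ + 1ℚ)) (PP-at θ) ⟨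
      N * (∣ PPᴸ at θ ∣ + 1ℚ)
        ≤⟨ proj₁ (proj₂ large θ K≤∣θ∣) ⟩
      ∣ QRᴸ at θ ∣
        ≡⟨ *-identityˡ _ ⟨
      1ℚ * ∣ QRᴸ at θ ∣
        ≤⟨ *-monoʳ-≤-nonNeg (∣ QRᴸ at θ ∣) {{∣-∣-nonNeg (QRᴸ at θ)}} 1≤∣2h∣ ⟩
      ∣ 2 /1 * h ∣ * ∣ QRᴸ at θ ∣
        ≡⟨ ∣p*q∣≡∣p∣*∣q∣ (2 /1 * h) (QRᴸ at θ) ⟨
      ∣ 2 /1 * h * (QRᴸ at θ) ∣
        ≡⟨ cong ∣_∣ (trans (cong (2 /1 * h *_) (QR-at θ)) (sym (*-assoc (2 /1 * h) _ _))) ⟩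
      ∣ 2 /1 * h * (θ - 2 /1) * (2 /1 * θ * θ + 10 /1 * θ - 1ℚ) ∣ ∎)
      where
      open ≤-Reasoning
      -- The factor 3 of the denominator 3 P² is absorbed into the bound, and |M| makes it
      -- nonnegative.
      N = ∣ M ∣ * 3 /1
      0≤N : 0ℚ ℚ.≤ N
      0≤N = 0≤* (0≤∣p∣ M) (nonNegative⁻¹ (3 /1))
      -- The second condition, |P| ≥ 1, keeps the denominator nonzero at the same point.
      large = both (QR-dominates N 0≤N) (coercive 1ℚ (4 /1 ∷ []) {0ℚ} (λ ()) 1ℚ)
      K = proj₁ large
      ∣e∣≢0 : ∣ e ∣ ≢ 0ℚ
      ∣e∣≢0 = <⇒≢ (0<∣p∣ e≢0) ∘ sym
      L = (K ÷ ∣ e ∣) {{≢-nonZero ∣e∣≢0}}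
      -- From h ≥ 1 follows h⁴ ≥ h ≥ L, and L |e| = K then gives |θ| ≥ K.
      h = 1ℚ ⊔ L
      1≤h : 1ℚ ℚ.≤ h
      1≤h = p≤p⊔q 1ℚ L
      1≤∣2h∣ : 1ℚ ℚ.≤ ∣ 2 /1 * h ∣
      1≤∣2h∣ = ≤-trans (*-mono-≤ {1ℚ} {2 /1} {1ℚ} {h} (nonNegative⁻¹ 1ℚ) (nonNegative⁻¹ 1ℚ) (p≤p+q {1ℚ} {1ℚ} (nonNegative⁻¹ 1ℚ)) 1≤h)
        (p≤∣p∣ (2 /1 * h))
      θ = e * (h * h * h * h)
      p = 4 /1 * θ + 1ℚ
      K≤∣θ∣ : K ℚ.≤ ∣ θ ∣
      K≤∣θ∣ = begin
        K                             ≡⟨ ÷-* K (∣ e ∣) ∣e∣≢0 ⟨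
        L * ∣ e ∣
          ≤⟨ *-monoʳ-≤-nonNeg (∣ e ∣) {{∣-∣-nonNeg e}} (≤-trans (p≤q⊔p 1ℚ L) (≤-trans (h≤h⁴ 1≤h) (p≤∣p∣ (h * h * h * h)))) ⟩
        ∣ h * h * h * h ∣ * ∣ e ∣     ≡⟨ *-comm (∣ h * h * h * h ∣) (∣ e ∣) ⟩
        ∣ e ∣ * ∣ h * h * h * h ∣     ≡⟨ ∣p*q∣≡∣p∣*∣q∣ e (h * h * h * h) ⟨
        ∣ θ ∣                         ∎
      p≢0 : p ≢ 0ℚ
      p≢0 = subst (_≢ 0ℚ) (P-at θ) (≢0-∣∣ (positive⁻¹ 1ℚ) (proj₂ (proj₂ large θ K≤∣θ∣)))

  solution : UnboundedSolution 4 0 3 0ℚ b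
  solution = record
    { x = x ; solves = solves
    ; c = λ _ → 1F ; c-inj = λ { 0F 0F _ → refl }
    ; num-var = λ () ; den-1 = λ ()
    ; C = con 1ℚ ; C≢0 = (λ _ → 0ℚ) , 1≢0
    ; unbounded = λ _ _ → unbounded
    }

-- Distribution of the cases

theorem2 : (n i : ℕ) → 4 ≤ n → 2 ≤ i → i < n → (a b : ℚ) → b ≢ 0ℚ →
    Σ (ℕ → Tuple n (n ∸ 3)) λ x →
    (∀ j → SolvesSystem i a b (x j) × DependsOnAll (x j)) ×
    (∀ j j' → j ≢ j' → ¬ (x j ≈ᵀ x j'))
theorem2 (suc (suc (suc (suc k)))) (suc (suc j)) (s≤s (s≤s (s≤s (s≤s _)))) (s≤s (s≤s _))
  (s≤s (s≤s (s≤s j≤1+k))) a b b≢0 with ℕ.m≤n⇒m<n∨m≡n j≤1+k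
... | inj₁ (s≤s j≤k) = infinitely-many (Middle.solution k j j≤k a b b≢0)
-- Now i = n - 1, and C must be nonzero. This is automatic for n ≥ 5; for n = 4 it means a ≠ 0, and
-- Euler's solution covers a = 0.
... | inj₂ refl with k | a ≟ 0ℚ
...   | suc k′ | _        = infinitely-many (LastButOne.solution (suc k′) a b b≢0 (LastButOne.C-nonZero (suc k′) a b b≢0 refl))
...   | zero   | yes refl = infinitely-many (Four.solution b b≢0)
-- Without free unknowns U = 1 and S = 0, so `C` is the constant a.
...   | zero   | no a≢0   = infinitely-many (LastButOne.solution 0 a b b≢0 ((λ _ → 0ℚ) , λ h → a≢0
          (trans (solve 2 (λ a b → a := a :* κ 1ℚ :- b :* κ 0ℚ) refl a b) h)))
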